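{- For all integers $k\ge 2$ and $m\ge 1$, $$g_k(m,2)\le f_{4+2(k-1)}\bigl(f_4(6m-2)\bigr),$$ where $g_k(m,2)$ is the minimal natural number $n$ such that for every coloring $c:\mathrm{FIN}_k(n)\to\{0,1\}$ there exists a block sequence of length $m$ of elements of $\mathrm{FIN}_k(n)$ such that $c$ is constant on the combinatorial space it generates, and $(f_i)_{i\ge 1}$ is the Ackermann hierarchy.
   Context: Ackermann hierarchy: the functions $f_i:\mathbb{N}\to\mathbb{N}$, $i\ge 1$, are defined by $f_1(x)=2x$ and $f_{i+1}(x)=f_i^{(x)}(1)$, where $f_i^{(x)}$ denotes the $x$-fold iterate of $f_i$. $\mathbb{N}$ starts at $0$. For $k\ge 1$, $\mathrm{FIN}_k$ is the set of all functions $h:\mathbb{N}\to\{0,1,\ldots,k\}$ that attain the maximum value $k$ and whose support $\mathrm{supp}(h)=\{n\in\mathbb{N}: h(n)\neq 0\}$ is finite. For $n\in\mathbb{N}$, $\mathrm{FIN}_k(n)=\{h\in\mathrm{FIN}_k:\max(\mathrm{supp}(h))<n\}$. For $g,h\in\mathrm{FIN}_k$ write $g<h$ if $\max(\mathrm{supp}(g))<\min(\mathrm{supp}(h))$. A block sequence of length $m$ is a sequence $(h_i)_{i<m}$ of elements of $\mathrm{FIN}_k$ with $h_i<h_j$ for all $i<j<m$. The tetris operation $T$ is defined pointwise by $(Th)(x)=\max\{0,h(x)-1\}$, and $T^l$ is its $l$-th iterate; sums of functions are pointwise. The combinatorial space generated by a block sequence $(h_i)_{i<m}$ is the set of all functions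 of the form $T^{l_0}(h_{i_0})+\cdots+T^{l_{p-1}}(h_{i_{p-1}})$ with $p\ge 1$, $i_0<\cdots<i_{p-1}<m$, $l_0,\ldots,l_{p-1}\in\mathbb{N}$ and $\min\{l_0,\ldots,l_{p-1}\}=0$. The number $g_k(m,2)$ exists for all $k\ge 1$ and $m$ (finite $\mathrm{FIN}_k$ theorem). -}

module Defs where

open import Algebra.Properties.CommutativeMonoid.Sum using (sum)
open import Data.Fin.Base as Fin using (Fin)
open import Data.Nat.Base using (ℕ; zero; suc; _*_; _∸_; _≤_; _<_; NonZero)
open import Data.Nat.GeneralisedArithmetic using (iterate)
open import Data.Nat.Properties using (+-0-commutativeMonoid)
open import Data.Product.Base using (Σ-syntax; ∃-syntax; _×_; proj₁)
open import Function.Base using (_∘_)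
open import Function.Bundles using (_⟶ₛ_; _⟨$⟩_)
open import Level using (0ℓ)
open import Relation.Binary.Bundles using (Setoid)
import Relation.Binary.Construct.On as On
open import Relation.Binary.Definitions using (Monotonic₁)
open import Relation.Binary.PropositionalEquality
  using (_≡_; _≢_; _≗_; setoid; _→-setoid_)
open import Relation.Unary using (Pred; _∈_)

f : (i : ℕ) → .{{NonZero i}} → ℕ → ℕ
f (suc zero)    x = 2 * x
f (suc (suc i)) x = iterate (f (suc i)) 1 x

supp : (ℕ → ℕ) → Pred ℕ 0ℓ
supp h x = h x ≢ 0

record FIN (k : ℕ) : Set where
  field
    fun       : ℕ → ℕ
    bounded   : ∀ x → fun x ≤ k
    attains   : ∃[ x ] fun x ≡ k
    finSupp   : ∃[ N ] (∀ x → x ∈ supp fun → x < N)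

open FIN public using (fun)

-- max (supp h) < n.
FINBelow : ℕ → ℕ → Set
FINBelow k n = Σ[ h ∈ FIN k ] (∀ x → x ∈ supp (fun h) → x < n)

-- Elements of FIN_k(n) are identified when they are equal as functions;
-- a coloring has to respect this identification.
FINSetoid : ℕ → ℕ → Setoid 0ℓ 0ℓ
FINSetoid k n = On.setoid {B = FINBelow k n} (ℕ →-setoid ℕ) (fun ∘ proj₁)

Coloring : (k n r : ℕ) → Set
Coloring k n r = FINSetoid k n ⟶ₛ setoid (Fin r)

-- max (supp g) < min (supp h), for nonempty supports.
infix 4 _≺_
_≺_ : ∀ {k} → FIN k → FIN k → Set
g ≺ h = ∀ x y → x ∈ supp (fun g) → y ∈ supp (fun h) → x < y

IsBlockSequence : ∀ {k m} → (Fin m → FIN k) → Set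
IsBlockSequence h = Monotonic₁ Fin._<_ _≺_ h

T : (ℕ → ℕ) → (ℕ → ℕ)
T h x = h x ∸ 1

-- The condition min {l₀, …, l_{p-1}} = 0 says that some l_j is 0.
Space : ∀ {k m} → (Fin m → FIN k) → Pred (ℕ → ℕ) 0ℓ
Space {m = m} h u =
  ∃[ p ] Σ[ i ∈ (Fin p → Fin m) ] Σ[ l ∈ (Fin p → ℕ) ]
    1 ≤ p
    × Monotonic₁ Fin._<_ Fin._<_ i
    × (∃[ j ] l j ≡ 0)
    × u ≗ λ x → sum +-0-commutativeMonoid (λ j → iterate T (fun (h (i j))) (l j) x)

-- For a block sequence in FIN_k(n), every element of the generated space is
-- again (the underlying function of) an element of FIN_k(n).
ConstantOnSpace : ∀ {k n r m} → Coloring k n r → (Fin m → FIN k) → Set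
ConstantOnSpace {k} {n} c h =
  (u v : FINBelow k n) → fun (proj₁ u) ∈ Space h → fun (proj₁ v) ∈ Space h →
  c ⟨$⟩ u ≡ c ⟨$⟩ v

Homogeneous : (k m r n : ℕ) → Set
Homogeneous k m r n =
  (c : Coloring k n r) →
  Σ[ h ∈ (Fin m → FINBelow k n) ]
    IsBlockSequence (proj₁ ∘ h) × ConstantOnSpace c (proj₁ ∘ h)

IsLeast : Pred ℕ 0ℓ → Pred ℕ 0ℓ
IsLeast P n = P n × (∀ n′ → P n′ → n ≤ n′)

-- IsG k m r n: the number g_k(m, r) exists and equals n.
IsG : (k m r : ℕ) → Pred ℕ 0ℓ
IsG k m r = IsLeast (Homogeneous k m r)

{-# OPTIONS --safe #-}
-- A block sequence cuts {0,…,n-1} into words, and the space it generates is the image of the words of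
-- FIN_k(m) under substitution.  Starting from a principle that makes all "low" words of a system equicoloured,
-- fusing it once (with all left contexts added to the colouring) and then once more (with all right contexts)
-- gives a system in which exchanging one low word for another inside any context preserves the colour.
-- Each of the two fusions iterates its input, hence costs one level of the hierarchy.
--
-- For k = 1 take the pigeonhole principle and words with a single 1: then the colour of a set depends only on its
-- size (Ramsey), and Folkman's theorem on finite sums yields finite unions with bound f₄.  From j to K = j + 1 take
-- as low words those of maximum j.  In the blocks T a + b + T c the guards T a, T c absorb all low parts around a
-- top letter, so the colour depends only on the set of blocks at top level, and finite unions finish the step.
module Submission where

open import Defs
open import Algebra.Properties.CommutativeMonoid.Sum using (sum-remove; sum-cong-≗; sum-replicate-zero) renaming (sum to ∑)
open import Data.Fin.Base as Fin using (Fin; toℕ; fromℕ<; funToFin; finToFun)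
open import Data.Fin.Properties as Fin
  using (finToFun-funToFin; toℕ-fromℕ<; toℕ<n; toℕ≤pred[n]; toℕ-injective; pigeonhole; any?; all?)
open import Data.List.Base
  using (List; []; _∷_; [_]; _++_; _∷ʳ_; length; map; take; drop; replicate; filter; tabulate; initLast; _∷ʳ′_)
open import Data.List.Membership.Propositional using (_∈_)
open import Data.List.Membership.Propositional.Properties using (∈-++⁺ˡ; ∈-++⁺ʳ; ∈-map⁺)
open import Data.List.Properties hiding (sum-++)
open import Data.List.Relation.Binary.Sublist.Propositional as Sublist using (_⊆_; []; _∷_; ⊆-trans)
open import Data.List.Relation.Binary.Sublist.Propositional.Properties using (All-resp-⊆; take-⊆; filter-⊆)
open import Data.List.Relation.Unary.All as All using (All; []; _∷_)
import Data.List.Relation.Unary.All.Properties as All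
open import Data.List.Relation.Unary.Any as Any using (here; there)
import Data.List.Relation.Unary.Any.Properties as AnyP
open import Data.Nat.Base
open import Data.Nat.GeneralisedArithmetic using (iterate)
open import Data.Nat.ListAction using (sum)
open import Data.Nat.ListAction.Properties using (sum-++)
open import Data.Nat.Properties
open import Data.Nat.Solver using (module +-*-Solver)
open import Data.Product.Base using (∃; ∃-syntax; Σ-syntax; _×_; _,_; proj₁; proj₂)
open import Data.Sum.Base using (inj₁; inj₂; [_,_]′)
open import Data.Unit.Base using (⊤)
open import Function.Base using (_∘_; id)
open import Function.Bundles using (Func; _⟨$⟩_)
open import Relation.Binary.Definitions using (tri<; tri≈; tri>)
open import Relation.Binary.PropositionalEquality
  using (_≡_; _≢_; _≗_; refl; sym; trans; cong; cong₂; subst; subst₂; module ≡-Reasoning)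
open import Relation.Nullary using (contradiction; ¬_; ¬?; yes; no; Dec; decidable-stable)
open import Relation.Nullary.Decidable using (map′; _×-dec_; _→-dec_)
open +-*-Solver using (solve; _:+_; _:*_; _:=_; con)

-- Words, block systems and substitution

-- The bound has two layers for the following reason. Finite unions are applied to a system that has
-- already been fused twice, so the number of blocks demanded of that system depends only on `m` and
-- the number of colours; this number accounts for the inner value of f₄. The outer function comes
-- from running the fusions for that many rounds, two levels above the bound for the previous `j`.
-- The index also enters through the r^(k+1) colours of each round, but the hierarchy grows in its
-- index too, and the outer function swallows this contribution before it can reach the argument.
-- The base case stays at level 4 in spite of its own two fusions: the pigeonhole bound is so small
-- that they lead only to double exponentials and then to towers, and Folkman's theorem dominates.
-- Constructively, an upper bound does not yet produce a least `n`: `Homogeneous` has to be decided,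
-- although `Space` quantifies over unbounded exponents and the colourings are functions on
-- functions. The finite search serves this purpose.

Word : Set
Word = List ℕ

-- scale k j is T^{k-j}: the letter j of a word over {0,…,k} selects the copy of maximum j, and 0 omits it.
scale : ℕ → ℕ → Word → Word
scale k j = map (_∸ (k ∸ j))

-- Stopping at the shorter of the two lists keeps `sub-++` and `sub-comp` free of length hypotheses.
sub : ℕ → List Word → Word → Word
sub k (w ∷ W) (j ∷ u) = scale k j w ++ sub k W u
sub k _       _       = []

comp : ℕ → List Word → List Word → List Word
comp k W []      = []
comp k W (v ∷ V) = sub k (take (length v) W) v ∷ comp k (drop (length v) W) V

width : List Word → ℕ
width W = sum (map length W)

-- A block sequence of n words from S, padded with zeros so that its blocks fill {0,…,N-1} exactly.
record System (S : Word → Set) (n N : ℕ) (W : List Word) : Set where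
  constructor system
  field
    size   : length W ≡ n
    total  : width W ≡ N
    member : All S W

open System public

Bounded : ℕ → Word → Set
Bounded k = All (_≤ k)

sub-[] : ∀ k W → sub k W [] ≡ []
sub-[] k []      = refl
sub-[] k (w ∷ W) = refl

sub-++ : ∀ k W z x → sub k W (z ++ x) ≡ sub k (take (length z) W) z ++ sub k (drop (length z) W) x
sub-++ k W       []      x = cong (_++ sub k W x) (sym (sub-[] k []))
sub-++ k []      (j ∷ z) x = refl
sub-++ k (w ∷ W) (j ∷ z) x = trans (cong (scale k j w ++_) (sub-++ k W z x)) (sym (++-assoc (scale k j w) _ _))

-- Truncated subtraction is the reason for the boundedness hypotheses on words. If `k ∸ j` is at
-- least `a`, the right side becomes `x ∸ k`, which vanishes because x ≤ k.
scale-entry : ∀ k {a} j {x} → a ≤ k → x ≤ k → x ∸ (k ∸ a) ∸ (k ∸ j) ≡ x ∸ (k ∸ (a ∸ (k ∸ j)))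
scale-entry k {a} j {x} a≤k x≤k = trans (∸-+-assoc x (k ∸ a) (k ∸ j)) eq
  where
  d = k ∸ j
  eq : x ∸ ((k ∸ a) + d) ≡ x ∸ (k ∸ (a ∸ d))
  eq with ≤-total d a
  ... | inj₁ d≤a = cong (x ∸_) (sym (begin
        k ∸ (a ∸ d)                     ≡⟨ cong (_∸ (a ∸ d)) (sym whole) ⟩
        ((k ∸ a) + d) + (a ∸ d) ∸ (a ∸ d) ≡⟨ m+n∸n≡m ((k ∸ a) + d) (a ∸ d) ⟩
        (k ∸ a) + d                     ∎))
    where
    open ≡-Reasoning
    whole : ((k ∸ a) + d) + (a ∸ d) ≡ k
    whole = trans (+-assoc (k ∸ a) d (a ∸ d)) (trans (cong ((k ∸ a) +_) (m+[n∸m]≡n d≤a)) (m∸n+n≡m a≤k))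
  ... | inj₂ a≤d = trans (m≤n⇒m∸n≡0 (≤-trans x≤k (≤-trans (≤-reflexive (sym (m∸n+n≡m a≤k))) (+-monoʳ-≤ (k ∸ a) a≤d))))
                         (sym (m≤n⇒m∸n≡0 (subst (λ b → x ≤ k ∸ b) (sym (m≤n⇒m∸n≡0 a≤d)) x≤k)))

scale-scale : ∀ k {a} j {w} → a ≤ k → Bounded k w → scale k j (scale k a w) ≡ scale k (a ∸ (k ∸ j)) w
scale-scale k j a≤k []          = refl
scale-scale k j a≤k (x≤k ∷ w≤k) = cong₂ _∷_ (scale-entry k j a≤k x≤k) (scale-scale k j a≤k w≤k)

scale-sub : ∀ k j {W v} → All (Bounded k) W → Bounded k v → scale k j (sub k W v) ≡ sub k W (scale k j v)
scale-sub k j {[]}    _        _         = refl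
scale-sub k j {_ ∷ _} _        []        = refl
scale-sub k j {w ∷ W} {a ∷ v} (bw ∷ bW) (a≤k ∷ bv) =
  trans (map-++ (_∸ (k ∸ j)) (scale k a w) (sub k W v))
        (cong₂ _++_ (scale-scale k j a≤k bw) (scale-sub k j bW bv))

-- Associativity of substitution: scaling commutes with substituting, and `sub-++` cuts `W` at the
-- seams between the words of `V`. Every passage from a system to a coarser one pulls its colouring
-- back along this equation.
sub-comp : ∀ k W V u → All (Bounded k) W → All (Bounded k) V →
           sub k (comp k W V) u ≡ sub k W (sub k V u)
sub-comp k W []      u       bW bV = sym (sub-[] k W)
sub-comp k W (v ∷ V) []      bW bV = sym (sub-[] k W)
sub-comp k W (v ∷ V) (j ∷ u) bW (bv ∷ bV) = begin
  scale k j (sub k W₁ v) ++ sub k (comp k W₂ V) u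
    ≡⟨ cong₂ _++_ (scale-sub k j (All.take⁺ l bW) bv) (sub-comp k W₂ V u (All.drop⁺ l bW) bV) ⟩
  sub k W₁ (scale k j v) ++ sub k W₂ (sub k V u)
    ≡⟨ cong (λ n → sub k (take n W) (scale k j v) ++ sub k (drop n W) (sub k V u)) (sym (length-map (_∸ (k ∸ j)) v)) ⟩
  _ ≡⟨ sym (sub-++ k W (scale k j v) (sub k V u)) ⟩
  sub k W (scale k j v ++ sub k V u) ∎
  where
  open ≡-Reasoning
  l = length v
  W₁ = take l W
  W₂ = drop l W

length-sub : ∀ k W u → length u ≡ length W → length (sub k W u) ≡ width W
length-sub k []      []      _  = refl
length-sub k (w ∷ W) (j ∷ u) eq =
  trans (length-++ (scale k j w)) (cong₂ _+_ (length-map _ w) (length-sub k W u (suc-injective eq)))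

width-++ : ∀ U V → width (U ++ V) ≡ width U + width V
width-++ U V = trans (cong sum (map-++ length U V)) (sum-++ (map length U) (map length V))

length-comp : ∀ k W V → length (comp k W V) ≡ length V
length-comp k W []      = refl
length-comp k W (v ∷ V) = cong suc (length-comp k (drop (length v) W) V)

module _ {m n : ℕ} {W : List Word} (eq : m + n ≡ length W) where

  length-take-+ : m ≡ length (take m W)
  length-take-+ = sym (trans (length-take m W) (m≤n⇒m⊓n≡m (subst (m ≤_) eq (m≤m+n m n))))

  length-drop-+ : n ≡ length (drop m W)
  length-drop-+ = sym (trans (length-drop m W) (trans (cong (_∸ m) (sym eq)) (m+n∸m≡n m n)))

width-comp : ∀ k W V → width V ≡ length W → width (comp k W V) ≡ width W
width-comp k []      []      eq = refl
width-comp k W       (v ∷ V) eq = begin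
  length (sub k W₁ v) + width (comp k W₂ V)
    ≡⟨ cong₂ _+_ (length-sub k W₁ v (length-take-+ {W = W} eq)) (width-comp k W₂ V (length-drop-+ {W = W} eq)) ⟩
  width W₁ + width W₂ ≡⟨ sym (width-++ W₁ W₂) ⟩
  width (W₁ ++ W₂)    ≡⟨ cong width (take++drop≡id l W) ⟩
  width W             ∎
  where
  open ≡-Reasoning
  l = length v
  W₁ = take l W
  W₂ = drop l W

comp-system : ∀ {S : Word → Set} k →
  (∀ {W v} → All S W → length v ≡ length W → S v → S (sub k W v)) →
  ∀ {n N M W V} → System S N M W → System S n N V → System S n M (comp k W V)
comp-system {S} k closed {W = W} {V} sW sV = record
  { size   = trans (length-comp k W V) (size sV)
  ; total  = trans (width-comp k W V eq) (total sW)
  ; member = go W V eq (member sW) (member sV)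
  }
  where
  eq = trans (total sV) (sym (size sW))
  go : ∀ W V → width V ≡ length W → All S W → All S V → All S (comp k W V)
  go W []      eq sW []        = []
  go W (v ∷ V) eq sW (sv ∷ sV) =
    closed (All.take⁺ (length v) sW) (length-take-+ {W = W} eq) sv ∷
    go (drop (length v) W) V (length-drop-+ {W = W} eq) (All.drop⁺ (length v) sW) sV

-- Fusion: words invariant under changing their low parts

Colouring : ℕ → Set
Colouring r = Word → Fin r

funToFin-injective : ∀ {m n} {g h : Fin m → Fin n} → funToFin g ≡ funToFin h → g ≗ h
funToFin-injective {g = g} {h} eq i =
  trans (sym (finToFun-funToFin g i)) (trans (cong (λ e → finToFun e i) eq) (finToFun-funToFin h i))

-- Packs the colours seen beside each possible letter into a single colour, so that one homogeneous
-- system serves all letters at once. The price is the growth from r to r^(k+1) colours.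
contexts : ∀ {r} k → (ℕ → Colouring r) → Colouring (r ^ suc k)
contexts k c u = funToFin {suc k} (λ j → c (toℕ j) u)

contexts-injective : ∀ {r} k (c : ℕ → Colouring r) {u v j} → j ≤ k →
                     contexts k c u ≡ contexts k c v → c j u ≡ c j v
contexts-injective k c {u} {v} j≤k eq =
  subst (λ j → c j u ≡ c j v) (toℕ-fromℕ< (s≤s j≤k)) (funToFin-injective {g = λ i → c (toℕ i) u} {λ i → c (toℕ i) v} eq (fromℕ< (s≤s j≤k)))

-- Y m r is the length that suffices for m + 1 words and r colours.
Iter : ℕ → (ℕ → ℕ → ℕ) → ℕ → ℕ → ℕ
Iter k Y zero    r = 0
Iter k Y (suc n) r = Y (Iter k Y n (r ^ suc k)) r

scale-bounded : ∀ {k} i j {w} → Bounded k w → Bounded k (scale i j w)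
scale-bounded i j = All.map⁺ ∘ All.map (λ {x} x≤k → ≤-trans (m∸n≤m x (i ∸ j)) x≤k)

sub-bounded : ∀ {k} i {W} u → All (Bounded k) W → Bounded k (sub i W u)
sub-bounded i []      []       = []
sub-bounded i []      (_ ∷ _)  = []
sub-bounded i (j ∷ u) []       = []
sub-bounded i (j ∷ u) (bw ∷ bW) = All.++⁺ (scale-bounded i j bw) (sub-bounded i u bW)

Homogenizes : ∀ {r} → ℕ → (Word → Set) → ℕ → Colouring r → List Word → Set
Homogenizes k L n c V =
  ∀ {x x′} → length x ≡ n → length x′ ≡ n → L x → L x′ → c (sub k V x) ≡ c (sub k V x′)

-- `S` holds of the words that serve as blocks, `L` of the low words to be exchanged. Both are
-- `Unit` for Ramsey's theorem; in the step from j to K they are FIN_K and FIN_j. The block `[ k ]`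
-- lets a position of a system pass through a composition unchanged.
module Refine (k : ℕ) (S L : Word → Set)
  (S-bounded : ∀ {w} → S w → Bounded k w)
  (S-closed  : ∀ {W v} → All S W → length v ≡ length W → S v → S (sub k W v))
  (L-closed  : ∀ {W v} → All S W → length v ≡ length W → L v → L (sub k W v))
  (S-[k]     : S [ k ]) where

  Base : (ℕ → ℕ → ℕ) → Set
  Base Y = ∀ m r (c : Colouring r) → ∃[ V ] System S (suc m) (Y m r) V × Homogenizes k L (suc m) c V

  RightInvariant : ∀ {r} → ℕ → Colouring r → List Word → Set
  RightInvariant n c V = ∀ z {x x′} → Bounded k z → length z + length x ≡ n → length x′ ≡ length x →
    L x → L x′ → c (sub k V (z ++ x)) ≡ c (sub k V (z ++ x′))

  Invariant : ∀ {r} → ℕ → Colouring r → List Word → Set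
  Invariant n c V = ∀ z {x x′} y → Bounded k z → Bounded k y →
    length z + (length x + length y) ≡ n → length x′ ≡ length x →
    L x → L x′ → c (sub k V (z ++ x ++ y)) ≡ c (sub k V (z ++ x′ ++ y))

  private
    S-bounded* : ∀ {W} → All S W → All (Bounded k) W
    S-bounded* = All.map S-bounded

  -- The blocks of `W` give all full-length low words one colour. The first block is set aside, and
  -- the others are regrouped so as to be invariant behind every first letter. If `z` is empty, `W`
  -- settles the claim, because regrouping keeps low words low; otherwise the first letter of `z` is
  -- one of the contexts already in the colouring.
  right-invariant : ∀ {Y} → Base Y → ∀ n r (c : Colouring r) →
    ∃[ V ] System S n (Iter k Y n r) V × RightInvariant n c V
  right-invariant base zero r c = [] , system refl refl [] , λ { [] {[]} {[]} _ _ _ _ _ → refl }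
  right-invariant {Y} base (suc n) r c
    with W , sW , hW ← base (Iter k Y n (r ^ suc k)) r c
    with V , sV , hV ← right-invariant base n (r ^ suc k) (contexts k λ j u → c (sub k W (j ∷ u)))
    = comp k W V⁺ , comp-system k S-closed sW sV⁺ , invariant
    where
    V⁺ = [ k ] ∷ V
    sV⁺ : System S (suc n) (suc (Iter k Y n (r ^ suc k))) V⁺
    sV⁺ = system (cong suc (size sV)) (cong suc (total sV)) (S-[k] ∷ member sV)

    unfold : ∀ u → c (sub k (comp k W V⁺) u) ≡ c (sub k W (sub k V⁺ u))
    unfold u = cong c (sub-comp k W V⁺ u (S-bounded* (member sW)) (S-bounded* (member sV⁺)))

    cons : ∀ {j} u → j ≤ k → sub k V⁺ (j ∷ u) ≡ j ∷ sub k V u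
    cons u j≤k = cong (_∷ sub k V u) (m∸[m∸n]≡n j≤k)

    invariant : RightInvariant (suc n) c (comp k W V⁺)
    invariant [] {x} {x′} _ lx lx′ Lx Lx′ = trans (unfold x) (trans
      (hW (trans (length-sub k V⁺ x lx″) (total sV⁺))
          (trans (length-sub k V⁺ x′ (trans lx′ lx″)) (total sV⁺))
          (L-closed (member sV⁺) lx″ Lx) (L-closed (member sV⁺) (trans lx′ lx″) Lx′))
      (sym (unfold x′)))
      where lx″ = trans lx (sym (size sV⁺))
    invariant (j ∷ z) {x} {x′} (j≤k ∷ bz) lzx lx′ Lx Lx′ = begin
      c (sub k (comp k W V⁺) (j ∷ z ++ x))  ≡⟨ unfold (j ∷ z ++ x) ⟩
      c (sub k W (sub k V⁺ (j ∷ z ++ x)))   ≡⟨ cong (λ u → c (sub k W u)) (cons (z ++ x) j≤k) ⟩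
      c (sub k W (j ∷ sub k V (z ++ x)))    ≡⟨ contexts-injective k (λ j u → c (sub k W (j ∷ u))) j≤k (hV z bz (suc-injective lzx) lx′ Lx Lx′) ⟩
      c (sub k W (j ∷ sub k V (z ++ x′)))   ≡⟨ cong (λ u → c (sub k W u)) (cons (z ++ x′) j≤k) ⟨
      c (sub k W (sub k V⁺ (j ∷ z ++ x′)))  ≡⟨ unfold (j ∷ z ++ x′) ⟨
      c (sub k (comp k W V⁺) (j ∷ z ++ x′)) ∎
      where open ≡-Reasoning

  -- The mirror image, with the last block set aside and `y` consumed from its right end. Once `y`
  -- is empty the exchanged word ends the whole word, and the right invariance of `W` applies,
  -- `sub k V₁ z` being just another left context. The `suc m` in the bound counts the block set
  -- aside.
  invariant : ∀ {Y} → Base Y → ∀ n r (c : Colouring r) →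
    ∃[ V ] System S n (Iter k (λ m → Iter k Y (suc m)) n r) V × Invariant n c V
  invariant base zero r c = [] , system refl refl [] , λ { [] {[]} {[]} [] _ _ _ _ _ _ → refl }
  invariant {Y} base (suc n) r c
    with W , sW , hW ← right-invariant base (suc (Iter k (λ m → Iter k Y (suc m)) n (r ^ suc k))) r c
    with V , sV , hV ← invariant base n (r ^ suc k) (contexts k λ j u → c (sub k W (u ∷ʳ j)))
    = comp k W V⁺ , comp-system k S-closed sW sV⁺ , go
    where
    V⁺ = V ∷ʳ [ k ]
    N = Iter k (λ m → Iter k Y (suc m)) n (r ^ suc k)
    sV⁺ : System S (suc n) (suc N) V⁺
    sV⁺ = system
      (trans (length-++ V) (trans (+-comm (length V) 1) (cong suc (size sV))))
      (trans (width-++ V _) (trans (+-comm (width V) 1) (cong suc (total sV))))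
      (All.∷ʳ⁺ (member sV) S-[k])

    unfold : ∀ u → c (sub k (comp k W V⁺) u) ≡ c (sub k W (sub k V⁺ u))
    unfold u = cong c (sub-comp k W V⁺ u (S-bounded* (member sW)) (S-bounded* (member sV⁺)))

    snoc : ∀ {j} V u → length u ≡ length V → j ≤ k → sub k (V ∷ʳ [ k ]) (u ∷ʳ j) ≡ sub k V u ∷ʳ j
    snoc []      []      eq j≤k = cong [_] (m∸[m∸n]≡n j≤k)
    snoc (v ∷ V) (i ∷ u) eq j≤k =
      trans (cong (scale k i v ++_) (snoc V u (suc-injective eq) j≤k))
            (sym (++-assoc (scale k i v) (sub k V u) [ _ ]))

    last : ∀ {j} z {x x′} y → Bounded k z → Bounded k y → j ≤ k →
      length z + (length x + length y) ≡ n → length x′ ≡ length x → L x → L x′ →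
      c (sub k W (sub k V⁺ ((z ++ x ++ y) ∷ʳ j))) ≡ c (sub k W (sub k V⁺ ((z ++ x′ ++ y) ∷ʳ j)))
    last {j} z {x} {x′} y bz by j≤k l lx′ Lx Lx′ = begin
      c (sub k W (sub k V⁺ ((z ++ x ++ y) ∷ʳ j)))  ≡⟨ cong (λ u → c (sub k W u)) (snoc V (z ++ x ++ y) (trans (len x) (trans l (sym (size sV)))) j≤k) ⟩
      c (sub k W (sub k V (z ++ x ++ y) ∷ʳ j))     ≡⟨ contexts-injective k (λ j u → c (sub k W (u ∷ʳ j))) j≤k (hV z y bz by l lx′ Lx Lx′) ⟩
      c (sub k W (sub k V (z ++ x′ ++ y) ∷ʳ j))    ≡⟨ cong (λ u → c (sub k W u)) (snoc V (z ++ x′ ++ y) (trans (len x′) (trans (cong (λ q → length z + (q + length y)) lx′) (trans l (sym (size sV))))) j≤k) ⟨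
      c (sub k W (sub k V⁺ ((z ++ x′ ++ y) ∷ʳ j))) ∎
      where
      open ≡-Reasoning
      len : ∀ x → length (z ++ x ++ y) ≡ length z + (length x + length y)
      len x = trans (length-++ z) (cong (length z +_) (length-++ x))

    go : Invariant (suc n) c (comp k W V⁺)
    go z {x} {x′} y bz by l lx′ Lx Lx′ with initLast y
    ... | [] = begin
      c (sub k (comp k W V⁺) (z ++ x ++ []))  ≡⟨ unfold _ ⟩
      c (sub k W (sub k V⁺ (z ++ x ++ [])))   ≡⟨ cong (λ u → c (sub k W (sub k V⁺ (z ++ u)))) (++-identityʳ x) ⟩
      c (sub k W (sub k V⁺ (z ++ x)))         ≡⟨ cong (λ u → c (sub k W u)) (sub-++ k V⁺ z x) ⟩
      c (sub k W (sub k V₁ z ++ sub k V₂ x))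
        ≡⟨ hW (sub k V₁ z) (sub-bounded k z (All.take⁺ (length z) (S-bounded* (member sV⁺))))
             (trans (cong₂ _+_ (length-sub k V₁ z l₁) (length-sub k V₂ x l₂))
               (trans (sym (width-++ V₁ V₂)) (trans (cong width (take++drop≡id (length z) V⁺)) (total sV⁺))))
             (trans (length-sub k V₂ x′ (trans lx′ l₂)) (sym (length-sub k V₂ x l₂)))
             (L-closed sV₂ l₂ Lx) (L-closed sV₂ (trans lx′ l₂) Lx′) ⟩
      c (sub k W (sub k V₁ z ++ sub k V₂ x′)) ≡⟨ cong (λ u → c (sub k W u)) (sub-++ k V⁺ z x′) ⟨
      c (sub k W (sub k V⁺ (z ++ x′)))        ≡⟨ cong (λ u → c (sub k W (sub k V⁺ (z ++ u)))) (++-identityʳ x′) ⟨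
      c (sub k W (sub k V⁺ (z ++ x′ ++ [])))  ≡⟨ unfold _ ⟨
      c (sub k (comp k W V⁺) (z ++ x′ ++ [])) ∎
      where
      open ≡-Reasoning
      V₁ = take (length z) V⁺
      V₂ = drop (length z) V⁺
      sV₂ = All.drop⁺ (length z) (member sV⁺)
      l′ : length z + length x ≡ length V⁺
      l′ = trans (cong (length z +_) (sym (+-identityʳ (length x)))) (trans l (sym (size sV⁺)))
      l₁ = length-take-+ {W = V⁺} l′
      l₂ = length-drop-+ {W = V⁺} l′
    ... | y′ ∷ʳ′ j = begin
      c (sub k (comp k W V⁺) (z ++ x ++ y′ ∷ʳ j))    ≡⟨ unfold _ ⟩
      c (sub k W (sub k V⁺ (z ++ x ++ y′ ∷ʳ j)))     ≡⟨ cong (λ u → c (sub k W (sub k V⁺ u))) (assoc x) ⟩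
      c (sub k W (sub k V⁺ ((z ++ x ++ y′) ∷ʳ j)))   ≡⟨ last z y′ bz (proj₁ (All.∷ʳ⁻ by)) (proj₂ (All.∷ʳ⁻ by)) l′ lx′ Lx Lx′ ⟩
      c (sub k W (sub k V⁺ ((z ++ x′ ++ y′) ∷ʳ j)))  ≡⟨ cong (λ u → c (sub k W (sub k V⁺ u))) (assoc x′) ⟨
      c (sub k W (sub k V⁺ (z ++ x′ ++ y′ ∷ʳ j)))    ≡⟨ unfold _ ⟨
      c (sub k (comp k W V⁺) (z ++ x′ ++ y′ ∷ʳ j))   ∎
      where
      open ≡-Reasoning
      assoc : ∀ x → z ++ x ++ y′ ∷ʳ j ≡ (z ++ x ++ y′) ∷ʳ j
      assoc x = trans (cong (z ++_) (sym (++-assoc x y′ [ j ]))) (sym (++-assoc z (x ++ y′) [ j ]))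
      l′ : length z + (length x + length y′) ≡ n
      l′ = suc-injective (trans (trans (sym (+-suc (length z) _))
             (cong (length z +_) (trans (sym (+-suc (length x) _))
               (cong (length x +_) (trans (+-comm 1 (length y′)) (sym (length-++ y′))))))) l)

-- Ramsey's theorem for unit words

length-filter-¬ : ∀ {A : Set} {P : A → Set} (P? : ∀ x → Dec (P x)) xs →
  length xs ≡ length (filter P? xs) + length (filter (λ x → ¬? (P? x)) xs)
length-filter-¬ P? []       = refl
length-filter-¬ P? (x ∷ xs) with P? x
... | yes _ = cong suc (length-filter-¬ P? xs)
... | no  _ = trans (cong suc (length-filter-¬ P? xs)) (sym (+-suc _ _))

-- Either the last colour occurs more than m times, or deleting it leaves enough elements for one
-- colour less. A sublist is returned because order matters to both users: positions of unit words,
-- and heads of sums.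
pigeonhole-⊆ : ∀ {A : Set} r m (c : A → ℕ) xs → All (λ x → c x < r) xs → r * m < length xs →
  ∃[ b ] ∃[ zs ] zs ⊆ xs × length zs ≡ suc m × All (λ z → c z ≡ b) zs
pigeonhole-⊆ zero    m c (x ∷ xs) (() ∷ _) _
pigeonhole-⊆ (suc r) m c xs c<1+r long with ≤-<-connex (suc m) (length ys)
  where ys = filter (λ x → c x ≟ r) xs
... | inj₁ 1+m≤ = r , take (suc m) ys , ⊆-trans (take-⊆ (suc m) ys) (filter-⊆ (λ x → c x ≟ r) xs) ,
                  trans (length-take (suc m) ys) (m≤n⇒m⊓n≡m 1+m≤) , All.take⁺ (suc m) (All.all-filter (λ x → c x ≟ r) xs)
  where ys = filter (λ x → c x ≟ r) xs
... | inj₂ <1+m =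
    let b , zs , zs⊆ , l , same = pigeonhole-⊆ r m c ys′ c<r long′
    in b , zs , ⊆-trans zs⊆ (filter-⊆ (λ x → ¬? (c x ≟ r)) xs) , l , same
  where
  ys  = filter (λ x → c x ≟ r) xs
  ys′ = filter (λ x → ¬? (c x ≟ r)) xs
  c<r : All (λ x → c x < r) ys′
  c<r = All.zipWith (λ (c<1+r , c≢r) → ≤∧≢⇒< (s≤s⁻¹ c<1+r) c≢r)
          (All-resp-⊆ (filter-⊆ (λ x → ¬? (c x ≟ r)) xs) c<1+r , All.all-filter (λ x → ¬? (c x ≟ r)) xs)
  long′ : r * m < length ys′
  long′ = +-cancelˡ-< m (r * m) (length ys′) (<-≤-trans long
            (≤-trans (≤-reflexive (length-filter-¬ (λ x → c x ≟ r) xs)) (+-monoˡ-≤ (length ys′) (s≤s⁻¹ <1+m))))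

-- The characteristic words of singletons.
Unit : Word → Set
Unit w = sum w ≡ 1

sum-bounded : ∀ w → Bounded (sum w) w
sum-bounded []      = []
sum-bounded (a ∷ w) = m≤m+n a (sum w) ∷ All.map (λ p → ≤-trans p (m≤n+m (sum w) a)) (sum-bounded w)

unit-bounded : ∀ {w} → Unit w → Bounded 1 w
unit-bounded {w} eq = subst (λ s → Bounded s w) eq (sum-bounded w)

scale-self : ∀ k w → scale k k w ≡ w
scale-self k w = trans (map-cong (λ x → cong (x ∸_) (n∸n≡0 k)) w) (map-id w)

sum-scale₀ : ∀ {k w} → Bounded k w → sum (scale k 0 w) ≡ 0
sum-scale₀ []        = refl
sum-scale₀ (p ∷ ps) = cong₂ _+_ (m≤n⇒m∸n≡0 p) (sum-scale₀ ps)

sum-sub-unit : ∀ {W v} → All Unit W → length v ≡ length W → Bounded 1 v → sum (sub 1 W v) ≡ sum v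
sum-sub-unit {[]}     {[]}    _        _  _  = refl
sum-sub-unit {w ∷ W} {a ∷ v} (uw ∷ uW) eq (a≤1 ∷ bv) =
  trans (sum-++ (scale 1 a w) _) (cong₂ _+_ (head a≤1) (sum-sub-unit uW (suc-injective eq) bv))
  where
  head : ∀ {a} → a ≤ 1 → sum (scale 1 a w) ≡ a
  head z≤n       = sum-scale₀ (unit-bounded {w} uw)
  head (s≤s z≤n) = trans (cong sum (scale-self 1 w)) uw

unit-closed : ∀ {W v} → All Unit W → length v ≡ length W → Unit v → Unit (sub 1 W v)
unit-closed {v = v} uW eq uv = trans (sum-sub-unit uW eq (unit-bounded {v} uv)) uv

sum-zero : ∀ w → sum w ≡ 0 → w ≡ replicate (length w) 0
sum-zero []         _  = refl
sum-zero (zero ∷ w) eq = cong (0 ∷_) (sum-zero w eq)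

sum-zeros : ∀ n → sum (replicate n 0) ≡ 0
sum-zeros zero    = refl
sum-zeros (suc n) = sum-zeros n

sum-ones : ∀ n → sum (replicate n 1) ≡ n
sum-ones zero    = refl
sum-ones (suc n) = cong suc (sum-ones n)

-- The colours are listed instead of the words, so that the pigeonhole principle applies directly;
-- the leading zeros accumulate inside the colouring.
units : (N : ℕ) → {A : Set} → (Word → A) → List A
units zero    c = []
units (suc N) c = c (1 ∷ replicate N 0) ∷ units N (c ∘ (0 ∷_))

length-units : ∀ N {A : Set} (c : Word → A) → length (units N c) ≡ N
length-units zero    c = refl
length-units (suc N) c = cong suc (length-units N (c ∘ (0 ∷_)))

-- Each kept position becomes the 1 of a block. A skipped position is a zero glued to the front of
-- the next block, and the zeros behind the last kept position close the last block, so the total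
-- width stays N.
unit-system : ∀ N {A : Set} (c : Word → A) z zs → z ∷ zs ⊆ units N c →
  ∃[ V ] System Unit (suc (length zs)) N V ×
    (∀ u → length u ≡ suc (length zs) → Unit u → c (sub 1 V u) ∈ z ∷ zs)
unit-system (suc N) c z zs (_ Sublist.∷ʳ s) with unit-system N (c ∘ (0 ∷_)) z zs s
... | w ∷ W , system n≡ N≡ (uw ∷ uW) , hits =
  (0 ∷ w) ∷ W , system n≡ (cong suc N≡) (uw ∷ uW) ,
  λ { (j ∷ u) lu uu → subst (λ a → c (a ∷ sub 1 (w ∷ W) (j ∷ u)) ∈ z ∷ zs) (sym (0∸n≡0 (1 ∸ j))) (hits (j ∷ u) lu uu) }
unit-system (suc N) c z []        (refl ∷ s) =
  [ 1 ∷ replicate N 0 ] ,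
  system refl (trans (+-identityʳ _) (cong suc (length-replicate N))) (cong suc (sum-zeros N) ∷ []) ,
  λ { (1 ∷ []) _ refl → here (cong c (trans (++-identityʳ _) (scale-self 1 _))) }
unit-system (suc N) c z (z′ ∷ zs) (refl ∷ s) with unit-system N (c ∘ (0 ∷_)) z′ zs s
... | V , sV , hits = [ 1 ] ∷ V , system (cong suc (size sV)) (cong suc (total sV)) (refl ∷ member sV) , hits′
  where
  hits′ : ∀ u → length u ≡ suc (suc (length zs)) → Unit u → c (sub 1 ([ 1 ] ∷ V) u) ∈ z ∷ z′ ∷ zs
  hits′ (0 ∷ u) lu uu = there (hits u (suc-injective lu) uu)
  hits′ (1 ∷ u) lu uu = here (cong (λ x → c (1 ∷ x)) (trans (sum-zero (sub 1 V u) zero-sum)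
                               (cong (λ n → replicate n 0) (trans (length-sub 1 V u lu′) (total sV)))))
    where
    lu′ = trans (suc-injective lu) (sym (size sV))
    zero-sum : sum (sub 1 V u) ≡ 0
    zero-sum = trans (sum-sub-unit (member sV) lu′ bu) (suc-injective uu)
      where
      bu = All.map (λ {i} p → ≤-trans (subst (i ≤_) (suc-injective uu) p) z≤n) (sum-bounded u)

module UnitRefinement = Refine 1 Unit Unit (λ {w} → unit-bounded {w}) unit-closed unit-closed refl

unit-base : UnitRefinement.Base (λ m r → suc (r * m))
unit-base m r c
  with b , z ∷ zs , zs⊆ , refl , same ← pigeonhole-⊆ r m toℕ (units (suc (r * m)) c) (All.universal toℕ<n _)
                                          (≤-reflexive (sym (length-units (suc (r * m)) c)))
  with V , sV , hits ← unit-system (suc (r * m)) c z zs zs⊆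
  = V , sV , λ {x} {x′} lx lx′ ux ux′ → toℕ-injective
      (trans (All.lookup same (hits x lx ux)) (sym (All.lookup same (hits x′ lx′ ux′))))

-- Folkman's theorem

data FS : List ℕ → ℕ → Set where
  []   : FS [] 0
  skip : ∀ {y ys s} → FS ys s → FS (y ∷ ys) s
  keep : ∀ {y ys s} → FS ys s → FS (y ∷ ys) (y + s)

FS-0 : ∀ ys → FS ys 0
FS-0 []       = []
FS-0 (y ∷ ys) = skip (FS-0 ys)

FS-sum : ∀ ys → FS ys (sum ys)
FS-sum []       = []
FS-sum (y ∷ ys) = keep (FS-sum ys)

FS-++ : ∀ {xs ys s t} → FS xs s → FS ys t → FS (xs ++ ys) (s + t)
FS-++ []       q = q
FS-++ (skip p) q = skip (FS-++ p q)
FS-++ {y ∷ xs} {ys} {t = t} (keep {s = s} p) q = subst (FS _) (sym (+-assoc y s t)) (keep (FS-++ p q))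

FS-⊆ : ∀ {ys zs s} → zs ⊆ ys → FS zs s → FS ys s
FS-⊆ []         p        = p
FS-⊆ (_ Sublist.∷ʳ q)   p        = skip (FS-⊆ q p)
FS-⊆ (refl ∷ q) (skip p) = skip (FS-⊆ q p)
FS-⊆ (refl ∷ q) (keep p) = keep (FS-⊆ q p)

FS-≤ : ∀ {ys s} → FS ys s → s ≤ sum ys
FS-≤ []           = z≤n
FS-≤ {y ∷ _} (skip p) = ≤-trans (FS-≤ p) (m≤n+m _ y)
FS-≤ {y ∷ _} (keep p) = +-monoʳ-≤ y (FS-≤ p)

cubeLength : ℕ → ℕ → ℕ
cubeLength zero    r = 1
cubeLength (suc D) r = r + cubeLength D (r ^ suc r)

segment : ∀ i j (ps : List ℕ) → i < j → j ≤ length ps → All (0 <_) ps →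
  ∃[ xs ] ∃[ ys ] ∃[ zs ] ps ≡ xs ++ ys ++ zs × sum (take i ps) ≡ sum xs ×
    sum (take j ps) ≡ sum xs + sum ys × 0 < sum ys
segment zero    (suc j) (p ∷ ps) _         _         (0<p ∷ _) =
  [] , take (suc j) (p ∷ ps) , drop (suc j) (p ∷ ps) , sym (take++drop≡id (suc j) (p ∷ ps)) , refl , refl ,
  ≤-trans 0<p (m≤m+n p _)
segment (suc i) (suc j) (p ∷ ps) (s≤s i<j) (s≤s j≤) (_ ∷ pos) =
  let xs , ys , zs , ps≡ , take-i , take-j , 0<ys = segment i j ps i<j j≤ pos
  in p ∷ xs , ys , zs , cong (p ∷_) ps≡ , cong (p +_) take-i ,
     trans (cong (p +_) take-j) (sym (+-assoc p (sum xs) (sum ys))) , 0<ys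

-- The first r entries have r+1 partial sums. Induction on the remaining entries, with t coloured by
-- the colours of all its translates by these sums, gives a cube on which each translate is
-- constant. Two translates of its base share a colour, and the difference of their partial sums is
-- the new direction d. This explains the r and the r^(r+1) in `cubeLength`.
hilbertCube : ∀ D {r} (χ : ℕ → Fin r) xs → length xs ≡ cubeLength D r → All (0 <_) xs →
  ∃[ a ] ∃[ ds ] length ds ≡ D × All (0 <_) (a ∷ ds) × (∀ {s} → FS (a ∷ ds) s → FS xs s) ×
    (∀ {s} → FS ds s → χ (a + s) ≡ χ a)
hilbertCube zero    χ (a ∷ []) refl pos = a , [] , refl , pos , (λ p → p) , λ { [] → cong χ (+-identityʳ a) }
hilbertCube (suc D) {r} χ xs len pos
  with a , ds , lds , 0<a ∷ 0<ds , FS⊆ , mono ← hilbertCube D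
         (λ t → funToFin {suc r} (λ i → χ (sum (take (toℕ i) (take r xs)) + t)))
         (drop r xs) (trans (length-drop r xs) (trans (cong (_∸ r) len) (m+n∸m≡n r _))) (All.drop⁺ r pos)
  with i , j , i<j , same ← pigeonhole (n<1+n r) (λ i → χ (sum (take (toℕ i) (take r xs)) + a))
  with us , vs , ws , ps≡ , take-i , take-j , 0<d ← segment (toℕ i) (toℕ j) (take r xs) i<j
         (≤-trans (s≤s⁻¹ (toℕ<n j)) (≤-reflexive (sym (trans (length-take r xs)
           (m≤n⇒m⊓n≡m (subst (r ≤_) (sym len) (m≤m+n r _))))))) (All.take⁺ r pos)
  = p + a , d ∷ ds , cong suc lds , (≤-trans 0<a (m≤n+m a p) ∷ 0<d ∷ 0<ds) , sums , constant
  where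
  p = sum us
  d = sum vs

  colour : ∀ {s} i → FS ds s →
    χ (sum (take (toℕ i) (take r xs)) + (a + s)) ≡ χ (sum (take (toℕ i) (take r xs)) + a)
  colour i q = funToFin-injective {g = λ i → χ (sum (take (toℕ i) (take r xs)) + (a + _))}
                                  {λ i → χ (sum (take (toℕ i) (take r xs)) + a)} (mono q) i

  prefix : ∀ {s t} → FS us s → FS vs t → FS (take r xs) (s + t)
  prefix {s} {t} q q′ = subst₂ FS (sym ps≡) (cong (s +_) (+-identityʳ t)) (FS-++ q (FS-++ q′ (FS-0 ws)))

  join : ∀ {s t} → FS (take r xs) s → FS (a ∷ ds) t → FS xs (s + t)
  join q q′ = subst (λ xs → FS xs _) (take++drop≡id r xs) (FS-++ q (FS⊆ q′))

  sums : ∀ {s} → FS (p + a ∷ d ∷ ds) s → FS xs s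
  sums (skip (skip q)) = join (FS-0 _) (skip q)
  sums (skip (keep q)) = join (prefix (FS-0 us) (FS-sum vs)) (skip q)
  sums (keep (skip {s = s} q)) = subst (FS xs) (sym (+-assoc p a s))
    (subst (λ p → FS xs (p + (a + s))) (+-identityʳ p) (join (prefix (FS-sum us) (FS-0 vs)) (keep q)))
  sums (keep (keep {s = s} q)) = subst (FS xs) eq (join (prefix (FS-sum us) (FS-sum vs)) (keep q))
    where
    open ≡-Reasoning
    eq : (p + d) + (a + s) ≡ (p + a) + (d + s)
    eq = begin
      (p + d) + (a + s) ≡⟨ +-assoc p d (a + s) ⟩
      p + (d + (a + s)) ≡⟨ cong (p +_) (trans (sym (+-assoc d a s)) (trans (cong (_+ s) (+-comm d a)) (+-assoc a d s))) ⟩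
      p + (a + (d + s)) ≡⟨ +-assoc p a (d + s) ⟨
      (p + a) + (d + s) ∎

  at-i : ∀ {s} → FS ds s → χ (p + (a + s)) ≡ χ (p + a)
  at-i q = subst (λ p → χ (p + (a + _)) ≡ χ (p + a)) take-i (colour i q)

  at-j : ∀ {s} → FS ds s → χ ((p + d) + (a + s)) ≡ χ (p + a)
  at-j q = trans (subst (λ p → χ (p + (a + _)) ≡ χ (p + a)) take-j (colour j q))
                 (subst₂ (λ p q → χ (q + a) ≡ χ (p + a)) take-i take-j (sym same))

  constant : ∀ {s} → FS (d ∷ ds) s → χ ((p + a) + s) ≡ χ (p + a)
  constant {s} (skip q) = trans (cong χ (+-assoc p a s)) (at-i q)
  constant (keep {s = s} q) = trans (cong χ eq) (at-j q)
    where
    open ≡-Reasoning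
    eq : (p + a) + (d + s) ≡ (p + d) + (a + s)
    eq = begin
      (p + a) + (d + s) ≡⟨ +-assoc p a (d + s) ⟩
      p + (a + (d + s)) ≡⟨ cong (p +_) (trans (sym (+-assoc a d s)) (trans (cong (_+ s) (+-comm a d)) (+-assoc d a s))) ⟩
      p + (d + (a + s)) ≡⟨ +-assoc p d (a + s) ⟨
      (p + d) + (a + s) ∎

HeadDetermined : ∀ {r} → (ℕ → Fin r) → List ℕ → Set
HeadDetermined χ []       = ⊤
HeadDetermined χ (y ∷ ys) = (∀ {s} → FS ys s → χ (y + s) ≡ χ y) × HeadDetermined χ ys

HeadDetermined-⊆ : ∀ {r} {χ : ℕ → Fin r} {ys zs} → zs ⊆ ys → HeadDetermined χ ys → HeadDetermined χ zs
HeadDetermined-⊆ []         h       = h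
HeadDetermined-⊆ (_ Sublist.∷ʳ q)   (_ , h) = HeadDetermined-⊆ q h
HeadDetermined-⊆ (refl ∷ q) (c , h) = (λ p → c (FS-⊆ q p)) , HeadDetermined-⊆ q h

headLength : ℕ → ℕ → ℕ
headLength r zero    = 0
headLength r (suc M) = cubeLength (headLength r M) r

-- The base of a Hilbert cube becomes the next element, and the directions of the cube are the
-- material for all later ones. Hence the required length is an iterate of the cube length, itself
-- bounded by a tower: this is the origin of f₄.
headDetermined : ∀ M {r} (χ : ℕ → Fin r) xs → length xs ≡ headLength r M → All (0 <_) xs →
  ∃[ ys ] length ys ≡ M × All (0 <_) ys × (∀ {s} → FS ys s → FS xs s) × HeadDetermined χ ys
headDetermined zero    χ [] _ _ = [] , refl , [] , (λ p → p) , _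
headDetermined (suc M) {r} χ xs len pos
  with a , ds , lds , 0<a ∷ 0<ds , FS⊆ , mono ← hilbertCube (headLength r M) χ xs len pos
  with ys , lys , 0<ys , FS⊆′ , h ← headDetermined M χ ds lds 0<ds
  = a ∷ ys , cong suc lys , 0<a ∷ 0<ys ,
    (λ { (skip p) → FS⊆ (skip (FS⊆′ p)) ; (keep p) → FS⊆ (keep (FS⊆′ p)) }) ,
    (λ p → mono (FS⊆′ p)) , h

head-colour : ∀ {r b} {χ : ℕ → Fin r} {ys s} → HeadDetermined χ ys → All (λ y → toℕ (χ y) ≡ b) ys →
  FS ys s → 0 < s → toℕ (χ s) ≡ b
head-colour h       same       []       ()
head-colour (_ , h) (_ ∷ same) (skip p) 0<s = head-colour h same p 0<s
head-colour (c , h) (e ∷ same) (keep p) 0<s = trans (cong toℕ (c p)) e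

folkmanBound : ℕ → ℕ → ℕ
folkmanBound m r = headLength r (suc (r * m))

folkman : ∀ m {r} (χ : ℕ → Fin r) →
  ∃[ ys ] length ys ≡ suc m × All (0 <_) ys × sum ys ≤ folkmanBound m r ×
    (∀ {s t} → FS ys s → FS ys t → 0 < s → 0 < t → χ s ≡ χ t)
folkman m {r} χ
  -- Starting from ones turns the bound on the number of entries into a bound on the sum of `ys`.
  with ys , lys , 0<ys , FS⊆ , h ← headDetermined (suc (r * m)) χ (replicate (folkmanBound m r) 1)
         (length-replicate (folkmanBound m r)) (All.replicate⁺ (folkmanBound m r) (s≤s z≤n))
  with b , zs , zs⊆ , lzs , same ← pigeonhole-⊆ r m (toℕ ∘ χ) ys (All.universal (λ y → toℕ<n (χ y)) ys) (≤-reflexive (sym lys))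
  = zs , lzs , All-resp-⊆ zs⊆ 0<ys ,
    ≤-trans (FS-≤ (FS⊆ (FS-⊆ zs⊆ (FS-sum zs)))) (≤-reflexive (sum-ones (folkmanBound m r))) ,
    λ p q 0<s 0<t → toℕ-injective (trans (head-colour (HeadDetermined-⊆ zs⊆ h) same p 0<s)
                                    (sym (head-colour (HeadDetermined-⊆ zs⊆ h) same q 0<t)))

-- The finite unions theorem

FINWord : ℕ → Word → Set
FINWord k w = Bounded k w × k ∈ w

FINWord-closed : ∀ {k W v} → All (FINWord k) W → length v ≡ length W → FINWord k v → FINWord k (sub k W v)
FINWord-closed {k} fW eq (bv , k∈v) = sub-bounded k _ (All.map proj₁ fW) , attains fW eq k∈v
  where
  attains : ∀ {W v} → All (FINWord k) W → length v ≡ length W → k ∈ v → k ∈ sub k W v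
  attains {w ∷ W} {_ ∷ v} ((_ , k∈w) ∷ fW) eq (here refl)  =
    ∈-++⁺ˡ (subst (k ∈_) (sym (scale-self k w)) k∈w)
  attains {w ∷ W} {j ∷ v} (_ ∷ fW)         eq (there k∈v) =
    ∈-++⁺ʳ (scale k j w) (attains fW (suc-injective eq) k∈v)

Gowers : (k m r N : ℕ) → Set
Gowers k m r N = (c : Colouring r) → ∃[ V ] System (FINWord k) m N V × Homogenizes k (FINWord k) m c V

unit-FINWord : ∀ {w} → Unit w → FINWord 1 w
unit-FINWord {w} uw = unit-bounded {w} uw , has-one w uw
  where
  has-one : ∀ w → Unit w → 1 ∈ w
  has-one (0 ∷ w) uw = there (has-one w uw)
  has-one (1 ∷ w) uw = here refl

canonical : ℕ → ℕ → Word
canonical n s = replicate s 1 ++ replicate (n ∸ s) 0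

sum≤length : ∀ {x} → Bounded 1 x → sum x ≤ length x
sum≤length []        = z≤n
sum≤length (p ∷ ps)  = +-mono-≤ p (sum≤length ps)

module _ {n r : ℕ} (c : Colouring r) (V : List Word) (inv : UnitRefinement.Invariant n c V) where

  private
    colour : Word → Fin r
    colour u = c (sub 1 V u)

  -- Both 01 and 10 are unit words of length 2, so invariance permits adjacent transpositions.
  -- Sorting all ones to the front then shows that only their number matters, for every size
  -- simultaneously.
  swap : ∀ z y → Bounded 1 z → Bounded 1 y → length z + (2 + length y) ≡ n →
         colour (z ++ 0 ∷ 1 ∷ y) ≡ colour (z ++ 1 ∷ 0 ∷ y)
  swap z y bz by len = inv z {0 ∷ 1 ∷ []} {1 ∷ 0 ∷ []} y bz by len refl refl refl

  private
    1≤1 : 1 ≤ 1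
    1≤1 = ≤-refl

    snoc : ∀ {z : Word} {a b} → length z + suc b ≡ n → length (z ++ [ a ]) + b ≡ n
    snoc {z} {a} {b} len = trans (cong (_+ b) (trans (length-++ z) (+-comm (length z) 1)))
                             (trans (sym (+-suc (length z) b)) len)

  bubble : ∀ s z t → Bounded 1 z → length z + suc (s + t) ≡ n →
           colour (z ++ 0 ∷ replicate s 1 ++ replicate t 0) ≡ colour (z ++ replicate s 1 ++ 0 ∷ replicate t 0)
  bubble zero    z t bz len = refl
  bubble (suc s) z t bz len = begin
    colour (z ++ 0 ∷ 1 ∷ y)               ≡⟨ swap z y bz by (trans (cong (λ l → length z + (2 + l)) ly) len) ⟩
    colour (z ++ 1 ∷ 0 ∷ y)               ≡⟨ cong colour (++-assoc z [ 1 ] (0 ∷ y)) ⟨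
    colour ((z ++ [ 1 ]) ++ 0 ∷ y)        ≡⟨ bubble s (z ++ [ 1 ]) t (All.++⁺ bz (1≤1 ∷ [])) (snoc {z} len) ⟩
    colour ((z ++ [ 1 ]) ++ replicate s 1 ++ 0 ∷ replicate t 0) ≡⟨ cong colour (++-assoc z [ 1 ] _) ⟩
    colour (z ++ 1 ∷ replicate s 1 ++ 0 ∷ replicate t 0) ∎
    where
    open ≡-Reasoning
    y = replicate s 1 ++ replicate t 0
    by : Bounded 1 y
    by = All.++⁺ (All.replicate⁺ s 1≤1) (All.replicate⁺ t z≤n)
    ly : length y ≡ s + t
    ly = trans (length-++ (replicate s 1)) (cong₂ _+_ (length-replicate s) (length-replicate t))

  sort : ∀ z x t → Bounded 1 z → Bounded 1 x → length z + length x ≡ n → sum x + t ≡ length x →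
         colour (z ++ x) ≡ colour (z ++ replicate (sum x) 1 ++ replicate t 0)
  sort z []      zero    bz _         len eq = refl
  sort z (0 ∷ x) zero    bz (_ ∷ bx)  len eq =
    contradiction (subst (_≤ length x) (trans (sym (+-identityʳ _)) eq) (sum≤length bx)) 1+n≰n
  sort z (0 ∷ x) (suc t) bz (_ ∷ bx)  len eq = begin
    colour (z ++ 0 ∷ x)        ≡⟨ cong colour (++-assoc z [ 0 ] x) ⟨
    colour ((z ++ [ 0 ]) ++ x) ≡⟨ sort (z ++ [ 0 ]) x t (All.++⁺ bz (z≤n ∷ [])) bx (snoc {z} len) eq′ ⟩
    colour ((z ++ [ 0 ]) ++ y) ≡⟨ cong colour (++-assoc z [ 0 ] y) ⟩
    colour (z ++ 0 ∷ y)        ≡⟨ bubble (sum x) z t bz (trans (cong (λ l → length z + suc l) eq′) len) ⟩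
    colour (z ++ replicate (sum x) 1 ++ 0 ∷ replicate t 0) ∎
    where
    open ≡-Reasoning
    y = replicate (sum x) 1 ++ replicate t 0
    eq′ = suc-injective (trans (sym (+-suc (sum x) t)) eq)
  sort z (1 ∷ x) t bz (_ ∷ bx) len eq = begin
    colour (z ++ 1 ∷ x)        ≡⟨ cong colour (++-assoc z [ 1 ] x) ⟨
    colour ((z ++ [ 1 ]) ++ x) ≡⟨ sort (z ++ [ 1 ]) x t (All.++⁺ bz (1≤1 ∷ [])) bx (snoc {z} len) (suc-injective eq) ⟩
    colour ((z ++ [ 1 ]) ++ y) ≡⟨ cong colour (++-assoc z [ 1 ] y) ⟩
    colour (z ++ 1 ∷ y)        ∎
    where
    open ≡-Reasoning
    y = replicate (sum x) 1 ++ replicate t 0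
  sort z (suc (suc _) ∷ _) _ _ (s≤s () ∷ _) _ _

  colour-canonical : ∀ x → Bounded 1 x → length x ≡ n → colour x ≡ colour (canonical n (sum x))
  colour-canonical x bx len = sort [] x (n ∸ sum x) [] bx len
    (trans (m+[n∸m]≡n (subst (sum x ≤_) len (sum≤length bx))) (sym len))

ramseyBound : ℕ → ℕ → ℕ
ramseyBound = Iter 1 (λ m → Iter 1 (λ m r → suc (r * m)) (suc m))

unionBound : ℕ → ℕ → ℕ
unionBound m r = ramseyBound (folkmanBound m r) r

-- The surplus of N zeros goes into the first block: the words of a system have to fill the
-- prescribed width exactly, while the numbers from Folkman's theorem may add up to less.
blocks : ℕ → List ℕ → List Word
blocks N []       = []
blocks N (y ∷ ys) = (replicate y 1 ++ replicate N 0) ∷ blocks 0 ys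

length-blocks : ∀ N ys → length (blocks N ys) ≡ length ys
length-blocks N []       = refl
length-blocks N (y ∷ ys) = cong suc (length-blocks 0 ys)

width-blocks : ∀ N y ys → width (blocks N (y ∷ ys)) ≡ sum (y ∷ ys) + N
width-blocks N y ys = begin
  length (replicate y 1 ++ replicate N 0) + width (blocks 0 ys)
    ≡⟨ cong₂ _+_ (trans (length-++ (replicate y 1)) (cong₂ _+_ (length-replicate y) (length-replicate N))) (rest ys) ⟩
  (y + N) + sum ys ≡⟨ trans (+-assoc y N _) (trans (cong (y +_) (+-comm N _)) (sym (+-assoc y _ N))) ⟩
  (y + sum ys) + N ∎
  where
  open ≡-Reasoning
  rest : ∀ ys → width (blocks 0 ys) ≡ sum ys
  rest []       = refl
  rest (y ∷ ys) = trans (width-blocks 0 y ys) (+-identityʳ _)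

blocks-FINWord : ∀ N {ys} → All (0 <_) ys → All (FINWord 1) (blocks N ys)
blocks-FINWord N []                           = []
blocks-FINWord N (_∷_ {suc y} 0<y 0<ys) =
  (All.++⁺ (All.replicate⁺ (suc y) ≤-refl) (All.replicate⁺ N z≤n) , here refl) ∷ blocks-FINWord 0 0<ys

blocks-FS : ∀ N ys {u} → Bounded 1 u → length u ≡ length ys → FS ys (sum (sub 1 (blocks N ys) u))
blocks-FS N []       []        _  = []
blocks-FS N (y ∷ ys) {j ∷ u} (j≤1 ∷ bu) eq =
  subst (FS (y ∷ ys)) (sym (sum-++ (scale 1 j w) _)) (head j≤1 (blocks-FS 0 ys bu (suc-injective eq)))
  where
  w = replicate y 1 ++ replicate N 0
  bw : Bounded 1 w
  bw = All.++⁺ (All.replicate⁺ y ≤-refl) (All.replicate⁺ N z≤n)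
  sum-w : sum w ≡ y
  sum-w = trans (sum-++ (replicate y 1) _) (trans (cong₂ _+_ (sum-ones y) (sum-zeros N)) (+-identityʳ y))
  head : ∀ {j s} → j ≤ 1 → FS ys s → FS (y ∷ ys) (sum (scale 1 j w) + s)
  head {s = s} z≤n       q = subst (λ a → FS (y ∷ ys) (a + s)) (sym (sum-scale₀ bw)) (skip q)
  head {s = s} (s≤s z≤n) q = subst (λ a → FS (y ∷ ys) (a + s)) (sym (trans (cong sum (scale-self 1 w)) sum-w)) (keep q)

-- In the Ramsey system the colour is a function of size, and a union of blocks of sizes `ys` has a
-- subset sum of `ys` as its size. Folkman's theorem is applied to the colouring of sizes.
finite-unions : ∀ m r → Gowers 1 (suc m) r (unionBound m r)
finite-unions m r c
  with V , sV , inv ← UnitRefinement.invariant unit-base (folkmanBound m r) r c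
  with y ∷ ys , lys , 0<ys , ys≤ , mono ← folkman m (λ s → c (sub 1 V (canonical (folkmanBound m r) s)))
  = comp 1 V U , comp-system 1 FINWord-closed sV′ sU , homogenized
  where
  n = folkmanBound m r
  U = blocks (n ∸ sum (y ∷ ys)) (y ∷ ys)
  sU : System (FINWord 1) (suc m) n U
  sU = system (trans (length-blocks (n ∸ sum (y ∷ ys)) (y ∷ ys)) lys)
              (trans (width-blocks (n ∸ sum (y ∷ ys)) y ys) (m+[n∸m]≡n ys≤))
              (blocks-FINWord (n ∸ sum (y ∷ ys)) 0<ys)
  sV′ : System (FINWord 1) n (unionBound m r) V
  sV′ = system (size sV) (total sV) (All.map (λ {w} → unit-FINWord {w}) (member sV))

  member-sum : ∀ {w} → 1 ∈ w → 0 < sum w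
  member-sum (here refl) = s≤s z≤n
  member-sum (there {x} {w} p) = ≤-trans (member-sum p) (m≤n+m (sum w) x)

  canonize : ∀ {x} → length x ≡ suc m → FINWord 1 x →
    c (sub 1 (comp 1 V U) x) ≡ c (sub 1 V (canonical n (sum (sub 1 U x))))
  canonize {x} lx (bx , _) = trans
    (cong c (sub-comp 1 V U x (All.map proj₁ (member sV′)) (All.map proj₁ (member sU))))
    (colour-canonical c V inv (sub 1 U x) (sub-bounded 1 x (All.map proj₁ (member sU)))
      (trans (length-sub 1 U x (trans lx (sym (size sU)))) (total sU)))

  homogenized : Homogenizes 1 (FINWord 1) (suc m) c (comp 1 V U)
  homogenized {x} {x′} lx lx′ fx fx′ = trans (canonize lx fx) (trans
    (mono (sums lx fx) (sums lx′ fx′) (positive lx fx) (positive lx′ fx′))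
    (sym (canonize lx′ fx′)))
    where
    sums : ∀ {x} → length x ≡ suc m → FINWord 1 x → FS (y ∷ ys) (sum (sub 1 U x))
    sums lx fx = blocks-FS (n ∸ sum (y ∷ ys)) (y ∷ ys) (proj₁ fx) (trans lx (sym lys))
    positive : ∀ {x} → length x ≡ suc m → FINWord 1 x → 0 < sum (sub 1 U x)
    positive lx fx = member-sum (proj₂ (FINWord-closed (member sU) (trans lx (sym (size sU))) fx))

-- From FIN_j to FIN_{j+1}

module _ (j : ℕ) where

  private
    K = suc j

  scale-≤ : ∀ {a w} → a ≤ K → Bounded K w → Bounded a (scale K a w)
  scale-≤ {a} a≤K = All.map⁺ ∘ All.map (λ x≤K → ≤-trans (∸-monoˡ-≤ (K ∸ a) x≤K) (≤-reflexive (m∸[m∸n]≡n a≤K)))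

  scale-∈ : ∀ {a w} → a ≤ K → K ∈ w → a ∈ scale K a w
  scale-∈ {a} {w} a≤K K∈w = subst (_∈ scale K a w) (m∸[m∸n]≡n a≤K) (∈-map⁺ (_∸ (K ∸ a)) K∈w)

  low-closed : ∀ {W v} → All (FINWord K) W → length v ≡ length W → FINWord j v → FINWord j (sub K W v)
  low-closed fW eq (bv , j∈v) = bounded fW bv , attains fW eq j∈v
    where
    bounded : ∀ {W v} → All (FINWord K) W → Bounded j v → Bounded j (sub K W v)
    bounded []             _           = []
    bounded (_ ∷ _)        []          = []
    bounded ((bw , _) ∷ fW) (a≤j ∷ bv) =
      All.++⁺ (All.map (λ p → ≤-trans p a≤j) (scale-≤ (m≤n⇒m≤1+n a≤j) bw)) (bounded fW bv)
    attains : ∀ {W v} → All (FINWord K) W → length v ≡ length W → j ∈ v → j ∈ sub K W v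
    attains ((_ , K∈w) ∷ fW) eq (here refl) = ∈-++⁺ˡ (scale-∈ (n≤1+n j) K∈w)
    attains {w ∷ _} {a ∷ _} (_ ∷ fW) eq (there p)   = ∈-++⁺ʳ (scale K a w) (attains fW (suc-injective eq) p)

  -- A right inverse of T that adds nothing to the support.
  raise : ℕ → ℕ
  raise zero    = zero
  raise (suc x) = suc (suc x)

  scale-raise : ∀ {a} w → a ≤ j → scale K a (map raise w) ≡ scale j a w
  scale-raise {a} w a≤j = trans (sym (map-∘ w)) (map-cong entry w)
    where
    entry : ∀ x → raise x ∸ (K ∸ a) ≡ x ∸ (j ∸ a)
    entry x rewrite +-∸-assoc 1 a≤j with x
    ... | zero  = sym (0∸n≡0 (j ∸ a))
    ... | suc x = refl

  sub-raise : ∀ W {v} → Bounded j v → sub K (map (map raise) W) v ≡ sub j W v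
  sub-raise []      _          = refl
  sub-raise (w ∷ W) []         = refl
  sub-raise (w ∷ W) (a≤j ∷ bv) = cong₂ _++_ (scale-raise w a≤j) (sub-raise W bv)

  raise-FINWord : 0 < j → ∀ {w} → FINWord j w → FINWord K (map raise w)
  raise-FINWord 0<j {w} (bw , j∈w) = All.map⁺ (All.map (λ {x} → raise-≤ {x}) bw) , subst (_∈ map raise w) (raise-j 0<j) (∈-map⁺ raise j∈w)
    where
    raise-≤ : ∀ {x} → x ≤ j → raise x ≤ K
    raise-≤ {zero}  _ = z≤n
    raise-≤ {suc x} p = s≤s p
    raise-j : ∀ {j} → 0 < j → raise j ≡ suc j
    raise-j (s≤s _) = refl

  width-map : (g : Word → Word) → (∀ w → length (g w) ≡ length w) → ∀ W → width (map g W) ≡ width W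
  width-map g lg W = cong sum (trans (sym (map-∘ W)) (map-cong lg W))

  module LowRefinement = Refine K (FINWord K) (FINWord j) proj₁ FINWord-closed low-closed (≤-refl ∷ [] , here refl)

  -- A low word uses only letters up to j, so at least one T is applied to each raised block and
  -- undoes the raising. The theorem for FIN_j thus transfers to low words over FIN_K with the same
  -- bound.
  low-base : 0 < j → ∀ {Y} → (∀ m r → Gowers j (suc m) r (Y m r)) → LowRefinement.Base Y
  low-base 0<j g m r c with V , system n≡ N≡ fV , hV ← g m r c =
    map (map raise) V ,
    system (trans (length-map _ V) n≡) (trans (width-map (map raise) (length-map raise) V) N≡)
           (All.map⁺ (All.map (raise-FINWord 0<j) fV)) ,
    λ lx lx′ fx fx′ → trans (cong c (sub-raise V (proj₁ fx)))
                        (trans (hV lx lx′ fx fx′) (cong c (sym (sub-raise V (proj₁ fx′)))))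

  -- What the letter x leaves of the block j K j (see `sub-triples`). For x = K both guards equal j,
  -- the maximum required of a low word.
  guarded : ℕ → Word
  guarded x = pred x ∷ x ∷ pred x ∷ []

  spread : Word → Word
  spread []      = []
  spread (x ∷ u) = guarded x ++ spread u

  length-spread : ∀ u → length (spread u) ≡ length u * 3
  length-spread []      = refl
  length-spread (x ∷ u) = cong (3 +_) (length-spread u)

  pred-≤ : ∀ {x} → x ≤ K → pred x ≤ K
  pred-≤ p = ≤-trans pred[n]≤n p

  spread-bounded : ∀ {u} → Bounded K u → Bounded K (spread u)
  spread-bounded []        = []
  spread-bounded (p ∷ ps) = pred-≤ p ∷ p ∷ pred-≤ p ∷ spread-bounded ps

  guarded-bounded : ∀ {x} → x ≤ j → Bounded j (guarded x)
  guarded-bounded p = ≤-trans pred[n]≤n p ∷ p ∷ ≤-trans pred[n]≤n p ∷ []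

  -- On letters up to K the factor `x ∸ j` is the indicator of x = K. In this form the map factors
  -- through words over {0,1}, where finite unions apply.
  tops : ℕ → ℕ
  tops x = K * (x ∸ j)

  tops-K : tops K ≡ K
  tops-K = trans (cong (K *_) (m+n∸n≡m 1 j)) (*-identityʳ K)

  tops-low : ∀ {x} → x ≤ j → tops x ≡ 0
  tops-low p = trans (cong (K *_) (m≤n⇒m∸n≡0 p)) (*-zeroʳ K)

  tops-≤ : ∀ {x} → x ≤ K → tops x ≤ K
  tops-≤ p = ≤-trans (*-monoʳ-≤ K (∸-monoˡ-≤ j p)) (≤-reflexive tops-K)

  ∈-tail : ∀ {x u} → x ≤ j → K ∈ x ∷ u → K ∈ u
  ∈-tail x≤j (here K≡x) = contradiction (≤-trans (≤-reflexive K≡x) x≤j) 1+n≰n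
  ∈-tail x≤j (there p)  = p

  module Spread {n r : ℕ} (c : Colouring r) (V : List Word) (inv : LowRefinement.Invariant n c V) where

    colour : Word → Fin r
    colour u = c (sub K V u)

    length-+3 : ∀ {a} x → length (a ++ guarded x) ≡ length a + 3
    length-+3 {a} x = length-++ a

    -- The word g of maximum j stays one when low letters are appended to it, so it can absorb them.
    absorbʳ : ∀ {u} z {g} → Bounded K z → FINWord j g → Bounded K u →
              length z + (length g + length u * 3) ≡ n →
              colour (z ++ g ++ spread u) ≡ colour (z ++ g ++ spread (map tops u))
    absorbʳ {[]}    z bz fg _ len = refl
    absorbʳ {x ∷ u} z {g} bz fg@(bg , j∈g) (x≤K ∷ bu) len with m≤n⇒m<n∨m≡n x≤K
    ... | inj₂ refl rewrite tops-K = begin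
      colour (z ++ g ++ j ∷ K ∷ j ∷ spread u)            ≡⟨ cong colour (assoc (spread u)) ⟩
      colour (z′ ++ [ j ] ++ spread u)                   ≡⟨ absorbʳ z′ bz′ (≤-refl ∷ [] , here refl) bu len′ ⟩
      colour (z′ ++ [ j ] ++ spread (map tops u))        ≡⟨ cong colour (assoc (spread (map tops u))) ⟨
      colour (z ++ g ++ j ∷ K ∷ j ∷ spread (map tops u)) ∎
      where
      open ≡-Reasoning
      z′ = z ++ g ++ j ∷ K ∷ []
      bz′ : Bounded K z′
      bz′ = All.++⁺ bz (All.++⁺ (All.map m≤n⇒m≤1+n bg) (n≤1+n j ∷ ≤-refl ∷ []))
      assoc : ∀ s → z ++ g ++ j ∷ K ∷ j ∷ s ≡ z′ ++ [ j ] ++ s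
      assoc s = trans (cong (z ++_) (sym (++-assoc g (j ∷ K ∷ []) (j ∷ s)))) (sym (++-assoc z (g ++ j ∷ K ∷ []) (j ∷ s)))
      len′ : length z′ + (1 + length u * 3) ≡ n
      len′ = begin
        length z′ + (1 + length u * 3) ≡⟨ cong (_+ (1 + length u * 3)) (trans (length-++ z) (cong (length z +_) (length-++ g))) ⟩
        length z + (length g + 2) + (1 + length u * 3)   ≡⟨ +-assoc (length z) _ _ ⟩
        length z + (length g + 2 + (1 + length u * 3))   ≡⟨ cong (length z +_) (+-assoc (length g) 2 _) ⟩
        length z + (length g + (3 + length u * 3))       ≡⟨ len ⟩
        n ∎
    ... | inj₁ (s≤s x≤j) rewrite tops-low x≤j = begin
      colour (z ++ g ++ guarded x ++ spread u)                ≡⟨ cong (λ s → colour (z ++ s)) (sym (++-assoc g (guarded x) _)) ⟩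
      colour (z ++ (g ++ guarded x) ++ spread u)              ≡⟨ absorbʳ z bz (fg′ x≤j) bu len′ ⟩
      colour (z ++ (g ++ guarded x) ++ spread (map tops u))   ≡⟨ inv z (spread (map tops u)) bz
             (spread-bounded (All.map⁺ (All.map tops-≤ bu))) len″ (trans (length-+3 {g} 0) (sym (length-+3 {g} x))) (fg′ x≤j) (fg′ z≤n) ⟩
      colour (z ++ (g ++ guarded 0) ++ spread (map tops u))   ≡⟨ cong (λ s → colour (z ++ s)) (++-assoc g (guarded 0) _) ⟩
      colour (z ++ g ++ guarded 0 ++ spread (map tops u))     ∎
      where
      open ≡-Reasoning
      fg′ : ∀ {x} → x ≤ j → FINWord j (g ++ guarded x)
      fg′ p = All.++⁺ bg (guarded-bounded p) , ∈-++⁺ˡ j∈g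
      len′ : length z + (length (g ++ guarded x) + length u * 3) ≡ n
      len′ = trans (cong (length z +_) (trans (cong (_+ length u * 3) (length-+3 {g} x)) (+-assoc (length g) 3 _))) len
      len″ : length z + (length (g ++ guarded x) + length (spread (map tops u))) ≡ n
      len″ = trans (cong (λ l → length z + (length (g ++ guarded x) + l))
                     (trans (length-spread (map tops u)) (cong (_* 3) (length-map tops u)))) len′

    -- In spread u the first occurrence of K is preceded by its guard j, which makes the low word before it one of maximum j.
    absorbˡ : ∀ {u} z {g g′} → Bounded K z → Bounded j g → Bounded j g′ → length g′ ≡ length g →
              Bounded K u → K ∈ u → length z + (length g + length u * 3) ≡ n →
              colour (z ++ g ++ spread u) ≡ colour (z ++ g′ ++ spread u)
    absorbˡ {x ∷ u} z {g} {g′} bz bg bg′ lg (x≤K ∷ bu) K∈ len with m≤n⇒m<n∨m≡n x≤K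
    ... | inj₂ refl = begin
      colour (z ++ g ++ j ∷ y)          ≡⟨ cong (λ s → colour (z ++ s)) (sym (++-assoc g [ j ] y)) ⟩
      colour (z ++ (g ++ [ j ]) ++ y)   ≡⟨ inv z y bz (≤-refl ∷ n≤1+n j ∷ spread-bounded bu) len′
                                             (trans (length-++ g′) (trans (cong (_+ 1) lg) (sym (length-++ g)))) (low bg) (low bg′) ⟩
      colour (z ++ (g′ ++ [ j ]) ++ y)  ≡⟨ cong (λ s → colour (z ++ s)) (++-assoc g′ [ j ] y) ⟩
      colour (z ++ g′ ++ j ∷ y)         ∎
      where
      open ≡-Reasoning
      y = K ∷ j ∷ spread u
      low : ∀ {g} → Bounded j g → FINWord j (g ++ [ j ])
      low {g} bg = All.++⁺ bg (≤-refl ∷ []) , ∈-++⁺ʳ g (here refl)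
      len′ : length z + (length (g ++ [ j ]) + length y) ≡ n
      len′ = begin
        length z + (length (g ++ [ j ]) + length y)        ≡⟨ cong (λ l → length z + (l + length y)) (length-++ g) ⟩
        length z + (length g + 1 + length y)               ≡⟨ cong (length z +_) (+-assoc (length g) 1 _) ⟩
        length z + (length g + (3 + length (spread u)))    ≡⟨ cong (λ l → length z + (length g + (3 + l))) (length-spread u) ⟩
        length z + (length g + (3 + length u * 3))         ≡⟨ len ⟩
        n ∎
    ... | inj₁ (s≤s x≤j) = begin
      colour (z ++ g ++ guarded x ++ spread u)     ≡⟨ cong (λ s → colour (z ++ s)) (sym (++-assoc g (guarded x) _)) ⟩
      colour (z ++ (g ++ guarded x) ++ spread u)   ≡⟨ absorbˡ z bz (All.++⁺ bg (guarded-bounded x≤j)) (All.++⁺ bg′ (guarded-bounded x≤j))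
              (trans (length-+3 {g′} x) (trans (cong (_+ 3) lg) (sym (length-+3 {g} x)))) bu (∈-tail x≤j K∈) len′ ⟩
      colour (z ++ (g′ ++ guarded x) ++ spread u)  ≡⟨ cong (λ s → colour (z ++ s)) (++-assoc g′ (guarded x) _) ⟩
      colour (z ++ g′ ++ guarded x ++ spread u)    ∎
      where
      open ≡-Reasoning
      len′ : length z + (length (g ++ guarded x) + length u * 3) ≡ n
      len′ = trans (cong (length z +_) (trans (cong (_+ length u * 3) (length-+3 {g} x)) (+-assoc (length g) 3 _))) len

    -- Low letters in front of the first K are erased by `absorbˡ`, which borrows the left guard of
    -- that K. From there on its right guard is the initial low word for `absorbʳ`. The hypothesis
    -- that K occurs ensures that a guard exists.
    normalize : ∀ {u} z → Bounded K z → Bounded K u → K ∈ u → length z + length u * 3 ≡ n →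
                colour (z ++ spread u) ≡ colour (z ++ spread (map tops u))
    normalize {x ∷ u} z bz (x≤K ∷ bu) K∈ len with m≤n⇒m<n∨m≡n x≤K
    ... | inj₂ refl rewrite tops-K = begin
      colour (z ++ j ∷ K ∷ j ∷ spread u)                ≡⟨ cong colour (++-assoc z (j ∷ K ∷ []) (j ∷ spread u)) ⟨
      colour (z′ ++ [ j ] ++ spread u)                  ≡⟨ absorbʳ z′ (All.++⁺ bz (n≤1+n j ∷ ≤-refl ∷ [])) (≤-refl ∷ [] , here refl) bu
                                                             (trans (cong (_+ (1 + length u * 3)) (length-++ z)) (trans (+-assoc (length z) 2 _) len)) ⟩
      colour (z′ ++ [ j ] ++ spread (map tops u))       ≡⟨ cong colour (++-assoc z (j ∷ K ∷ []) (j ∷ spread (map tops u))) ⟩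
      colour (z ++ j ∷ K ∷ j ∷ spread (map tops u))     ∎
      where
      open ≡-Reasoning
      z′ = z ++ j ∷ K ∷ []
    ... | inj₁ (s≤s x≤j) rewrite tops-low x≤j = begin
      colour (z ++ guarded x ++ spread u)              ≡⟨ absorbˡ z bz (guarded-bounded x≤j) (guarded-bounded z≤n) refl bu K∈u len ⟩
      colour (z ++ guarded 0 ++ spread u)              ≡⟨ cong colour (++-assoc z (guarded 0) (spread u)) ⟨
      colour ((z ++ guarded 0) ++ spread u)            ≡⟨ normalize (z ++ guarded 0) (All.++⁺ bz (z≤n ∷ z≤n ∷ z≤n ∷ [])) bu K∈u
                                                            (trans (cong (_+ length u * 3) (length-+3 {z} 0)) (trans (+-assoc (length z) 3 _) len)) ⟩
      colour ((z ++ guarded 0) ++ spread (map tops u)) ≡⟨ cong colour (++-assoc z (guarded 0) (spread (map tops u))) ⟩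
      colour (z ++ guarded 0 ++ spread (map tops u))   ∎
      where
      open ≡-Reasoning
      K∈u = ∈-tail x≤j K∈

  -- Reduction of the top level to finite unions

  stepBound : (ℕ → ℕ → ℕ) → ℕ → ℕ → ℕ
  stepBound Y m r = Iter K (λ m → Iter K Y (suc m)) (unionBound m r * 3) r

  scale-tops : ∀ {a} w → Bounded 1 w → a ≤ K → map (_∸ j) (scale K a (map (K *_) w)) ≡ scale 1 (a ∸ j) w
  scale-tops []      _          _   = refl
  scale-tops {a} (b ∷ w) (b≤1 ∷ bw) a≤K = cong₂ _∷_ (entry b≤1) (scale-tops w bw a≤K)
    where
    entry : ∀ {b} → b ≤ 1 → K * b ∸ (K ∸ a) ∸ j ≡ b ∸ (1 ∸ (a ∸ j))
    entry z≤n       = trans (cong (λ y → y ∸ (K ∸ a) ∸ j) (*-zeroʳ K))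
                        (trans (cong (_∸ j) (0∸n≡0 (K ∸ a))) (trans (0∸n≡0 j) (sym (0∸n≡0 (1 ∸ (a ∸ j))))))
    entry (s≤s z≤n) = trans (cong (λ y → y ∸ (K ∸ a) ∸ j) (*-identityʳ K))
                        (trans (cong (_∸ j) (m∸[m∸n]≡n a≤K))
                          (sym (m∸[m∸n]≡n (≤-trans (∸-monoˡ-≤ j a≤K) (≤-reflexive (m+n∸n≡m 1 j))))))

  -- Reading off the top level commutes with substitution: a block with letters 0 and K reaches
  -- level K precisely under the letter K, and otherwise drops to j or below.
  sub-tops : ∀ W {v} → All (Bounded 1) W → Bounded K v →
             map (_∸ j) (sub K (map (map (K *_)) W) v) ≡ sub 1 W (map (_∸ j) v)
  sub-tops []      _         _          = refl
  sub-tops (w ∷ W) _         []         = refl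
  sub-tops (w ∷ W) {a ∷ v} (bw ∷ bW) (a≤K ∷ bv) =
    trans (map-++ (_∸ j) (scale K a (map (K *_) w)) (sub K (map (map (K *_)) W) v)) (cong₂ _++_ (scale-tops w bw a≤K) (sub-tops W bW bv))

  triples : ℕ → List Word
  triples M = replicate M (j ∷ K ∷ j ∷ [])

  sub-triples : ∀ M {u} → Bounded K u → length u ≡ M → sub K (triples M) u ≡ spread u
  sub-triples zero    {[]}    _          _  = refl
  sub-triples (suc M) {x ∷ u} (x≤K ∷ bu) eq =
    cong₂ _++_ (cong₂ (λ a b → a ∷ b ∷ a ∷ []) (entry x≤K) (m∸[m∸n]≡n x≤K)) (sub-triples M bu (suc-injective eq))
    where
    entry : ∀ {x} → x ≤ K → j ∸ (K ∸ x) ≡ pred x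
    entry {zero}  _         = m≤n⇒m∸n≡0 (n≤1+n j)
    entry {suc x} (s≤s x≤j) = m∸[m∸n]≡n x≤j

  triples-system : ∀ M → System (FINWord K) M (M * 3) (triples M)
  triples-system M = system (length-replicate M) (w M)
    (All.replicate⁺ M ((n≤1+n j ∷ ≤-refl ∷ n≤1+n j ∷ []) , there (here refl)))
    where
    w : ∀ M → width (triples M) ≡ M * 3
    w zero    = refl
    w (suc M) = cong (3 +_) (w M)

  *-FINWord : ∀ {w} → FINWord 1 w → FINWord K (map (K *_) w)
  *-FINWord {w} (bw , 1∈w) =
    All.map⁺ (All.map (λ b≤1 → ≤-trans (*-monoʳ-≤ K b≤1) (≤-reflexive (*-identityʳ K))) bw) ,
    subst (_∈ map (K *_) w) (*-identityʳ K) (∈-map⁺ (K *_) 1∈w)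

  ∸-FINWord : ∀ {x} → FINWord K x → FINWord 1 (map (_∸ j) x)
  ∸-FINWord {x} (bx , K∈x) =
    All.map⁺ (All.map (λ p → ≤-trans (∸-monoˡ-≤ j p) (≤-reflexive (m+n∸n≡m 1 j))) bx) ,
    subst (_∈ map (_∸ j) x) (m+n∸n≡m 1 j) (∈-map⁺ (_∸ j) K∈x)

  -- Three layers are composed: the fused blocks `V`, their grouping into guarded triples, and the
  -- union system `U` stretched from {0,1} to {0,K}. Each position of `U` takes one triple, whence
  -- the factor 3 in `stepBound`.
  gowers-step : 0 < j → ∀ {Y} → (∀ m r → Gowers j (suc m) r (Y m r)) → ∀ m r → Gowers K (suc m) r (stepBound Y m r)
  gowers-step 0<j {Y} g m r c
    with V , sV , inv ← LowRefinement.invariant (low-base 0<j g) (unionBound m r * 3) r c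
    with U , sU , hU ← finite-unions m r (λ b → c (sub K V (spread (map (K *_) b))))
    = comp K V (comp K (triples M) U′) , comp-system K FINWord-closed sV (comp-system K FINWord-closed (triples-system M) sU′) , homogenized
    where
    M = unionBound m r
    U′ = map (map (K *_)) U
    sU′ : System (FINWord K) (suc m) M U′
    sU′ = system (trans (length-map _ U) (size sU)) (trans (width-map (map (K *_)) (length-map (K *_)) U) (total sU))
                 (All.map⁺ (All.map *-FINWord (member sU)))
    bounded : ∀ {W} → All (FINWord K) W → All (Bounded K) W
    bounded = All.map proj₁

    canonize : ∀ {x} → length x ≡ suc m → FINWord K x →
      c (sub K (comp K V (comp K (triples M) U′)) x) ≡ c (sub K V (spread (map (K *_) (sub 1 U (map (_∸ j) x)))))
    canonize {x} lx fx = begin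
      c (sub K (comp K V (comp K (triples M) U′)) x)
        ≡⟨ cong c (sub-comp K V _ x (bounded (member sV)) (bounded (member (comp-system K FINWord-closed (triples-system M) sU′)))) ⟩
      c (sub K V (sub K (comp K (triples M) U′) x))
        ≡⟨ cong (λ y → c (sub K V y)) (sub-comp K (triples M) U′ x (bounded (member (triples-system M))) (bounded (member sU′))) ⟩
      c (sub K V (sub K (triples M) u))
        ≡⟨ cong (λ y → c (sub K V y)) (sub-triples M (proj₁ fu) lu) ⟩
      c (sub K V (spread u))
        ≡⟨ Spread.normalize c V inv [] [] (proj₁ fu) (proj₂ fu) (cong (_* 3) lu) ⟩
      c (sub K V (spread (map tops u)))
        ≡⟨ cong (λ y → c (sub K V (spread y))) (trans (map-∘ u) (cong (map (K *_)) (sub-tops U (All.map proj₁ (member sU)) (proj₁ fx)))) ⟩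
      c (sub K V (spread (map (K *_) (sub 1 U (map (_∸ j) x))))) ∎
      where
      open ≡-Reasoning
      u = sub K U′ x
      lx′ = trans lx (sym (size sU′))
      fu : FINWord K u
      fu = FINWord-closed (member sU′) lx′ fx
      lu : length u ≡ M
      lu = trans (length-sub K U′ x lx′) (total sU′)

    homogenized : Homogenizes K (FINWord K) (suc m) c (comp K V (comp K (triples M) U′))
    homogenized {x} {x′} lx lx′ fx fx′ = trans (canonize lx fx) (trans
      (hU (trans (length-map _ x) lx) (trans (length-map _ x′) lx′) (∸-FINWord fx) (∸-FINWord fx′))
      (sym (canonize lx′ fx′)))

gowersBound : ℕ → ℕ → ℕ → ℕ
gowersBound zero    = unionBound
gowersBound (suc j) = stepBound (suc j) (gowersBound j)

gowers : ∀ j m r → Gowers (suc j) (suc m) r (gowersBound j m r)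
gowers zero    = finite-unions
gowers (suc j) = gowers-step (suc j) (s≤s z≤n) (gowers j)

-- Words as elements of FIN_k

sumFin : ∀ {n} → (Fin n → ℕ) → ℕ
sumFin g = ∑ +-0-commutativeMonoid g

Σ-zero : ∀ {n} (g : Fin n → ℕ) → (∀ i → g i ≡ 0) → sumFin g ≡ 0
Σ-zero {n} g g≡0 = trans (sum-cong-≗ +-0-commutativeMonoid g≡0) (sum-replicate-zero +-0-commutativeMonoid n)

Σ-single : ∀ {n} (g : Fin n → ℕ) i → (∀ j → j ≢ i → g j ≡ 0) → sumFin g ≡ g i
Σ-single {suc n} g i others = trans (sum-remove +-0-commutativeMonoid g)
  (trans (cong (g i +_) (Σ-zero _ (λ j → others (Fin.punchIn i j) (Fin.punchInᵢ≢i i j)))) (+-identityʳ (g i)))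

iterate-T : ∀ h l x → iterate T h l x ≡ h x ∸ l
iterate-T h zero    x = refl
iterate-T h (suc l) x = trans (iterate-T (T h) l x) (∸-+-assoc (h x) 1 l)

-- Assigns a level to every block, level 0 meaning that T^k erases it. These level vectors are the
-- words of FIN_k(m), and unlike the data in `Space` they range over a finite set.
NormalSpace : ∀ {k m} → (Fin m → FIN k) → (ℕ → ℕ) → Set
NormalSpace {k} {m} h u = Σ[ L ∈ (Fin m → Fin (suc k)) ]
  (∃[ s ] toℕ (L s) ≡ k) × u ≗ λ x → sumFin (λ s → fun (h s) x ∸ (k ∸ toℕ (L s)))

normal⇒space : ∀ {k m} (h : Fin m → FIN k) {u} → NormalSpace h u → Space h u
normal⇒space {k} {m} h (L , (s , Ls≡k) , u≗) =
  m , id , (λ s → k ∸ toℕ (L s)) , ≤-trans (s≤s z≤n) (toℕ<n s) , id ,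
  (s , trans (cong (k ∸_) Ls≡k) (n∸n≡0 k)) ,
  λ x → trans (u≗ x) (sum-cong-≗ +-0-commutativeMonoid λ s → sym (iterate-T (fun (h s)) (k ∸ toℕ (L s)) x))

≺-disjoint : ∀ {k m} {h : Fin m → FIN k} → IsBlockSequence h → ∀ {s t x} →
             fun (h s) x ≢ 0 → t ≢ s → fun (h t) x ≡ 0
≺-disjoint {h = h} block {s} {t} {x} hs≢0 t≢s = decidable-stable (fun (h t) x ≟ 0) λ ht≢0 → go ht≢0 (Fin.<-cmp t s)
  where
  go : fun (h t) x ≢ 0 → _ → _
  go ht≢0 (tri< t<s _ _)  = <-irrefl refl (block t<s x x ht≢0 hs≢0)
  go ht≢0 (tri≈ _ t≡s _) = t≢s t≡s
  go ht≢0 (tri> _ _ s<t)  = <-irrefl refl (block s<t x x hs≢0 ht≢0)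

-- Exponents above k act like k, so levels between 0 and k represent all of them.
∸-∸-cap : ∀ {k a} l → a ≤ k → a ∸ l ≡ a ∸ (k ∸ (k ∸ l))
∸-∸-cap {k} {a} l a≤k with ≤-total l k
... | inj₁ l≤k = cong (a ∸_) (sym (m∸[m∸n]≡n l≤k))
... | inj₂ k≤l = trans (m≤n⇒m∸n≡0 (≤-trans a≤k k≤l))
                   (sym (trans (cong (λ d → a ∸ (k ∸ d)) (m≤n⇒m∸n≡0 k≤l)) (m≤n⇒m∸n≡0 a≤k)))

-- Blocks have disjoint supports, so at each point at most one summand survives on either side. The
-- strictly increasing `i` selects a block at most once, which makes its level well defined.
space⇒normal : ∀ {k m} (h : Fin m → FIN k) → IsBlockSequence h → ∀ {u} → Space h u → NormalSpace h u
space⇒normal {k} {m} h block {u} (p , i , l , _ , i-mono , (j₀ , lj₀≡0) , u≗) =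
  L , (i j₀ , L-top) , λ x → trans (u≗ x) (trans (sum-cong-≗ +-0-commutativeMonoid (λ j → iterate-T _ (l j) x)) (pointwise x))
  where
  level : ∀ s → Dec (∃[ j ] i j ≡ s) → ℕ
  level s (yes (j , _)) = k ∸ l j
  level s (no _)        = 0

  level< : ∀ s d → level s d < suc k
  level< s (yes (j , _)) = s≤s (m∸n≤m k (l j))
  level< s (no _)        = s≤s z≤n

  hit? : ∀ s → Dec (∃[ j ] i j ≡ s)
  hit? s = any? (λ j → i j Fin.≟ s)

  L : Fin m → Fin (suc k)
  L s = fromℕ< (level< s (hit? s))

  i-injective : ∀ {j j′} → i j ≡ i j′ → j ≡ j′
  i-injective {j} {j′} eq with Fin.<-cmp j j′
  ... | tri< j<j′ _ _ = contradiction (cong toℕ eq) (<⇒≢ (i-mono j<j′))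
  ... | tri≈ _ j≡j′ _ = j≡j′
  ... | tri> _ _ j′<j = contradiction (cong toℕ (sym eq)) (<⇒≢ (i-mono j′<j))

  L-hit : ∀ j → toℕ (L (i j)) ≡ k ∸ l j
  L-hit j = trans (toℕ-fromℕ< (level< (i j) (hit? (i j)))) (go (hit? (i j)))
    where
    go : ∀ d → level (i j) d ≡ k ∸ l j
    go (yes (j′ , eq)) = cong (λ j → k ∸ l j) (i-injective eq)
    go (no ¬hit)       = contradiction (j , refl) ¬hit

  L-miss : ∀ s → (∀ j → i j ≢ s) → toℕ (L s) ≡ 0
  L-miss s miss = trans (toℕ-fromℕ< (level< s (hit? s))) (go (hit? s))
    where
    go : ∀ d → level s d ≡ 0
    go (yes (j , eq)) = contradiction eq (miss j)
    go (no _)         = refl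

  L-top : toℕ (L (i j₀)) ≡ k
  L-top = trans (L-hit j₀) (cong (k ∸_) lj₀≡0)

  pointwise : ∀ x → sumFin (λ j → fun (h (i j)) x ∸ l j) ≡ sumFin (λ s → fun (h s) x ∸ (k ∸ toℕ (L s)))
  pointwise x with any? (λ s → ¬? (fun (h s) x ≟ 0))
  ... | no none = trans (Σ-zero _ (λ j → vanish (l j) (zeros (i j)))) (sym (Σ-zero _ (λ s → vanish (k ∸ toℕ (L s)) (zeros s))))
    where
    zeros : ∀ s → fun (h s) x ≡ 0
    zeros s = decidable-stable (fun (h s) x ≟ 0) (λ ne → none (s , ne))
    vanish : ∀ {a} l → a ≡ 0 → a ∸ l ≡ 0
    vanish l refl = 0∸n≡0 l
  ... | yes (s , hs≢0) = trans left (sym (Σ-single _ s (λ t t≢s → vanish (k ∸ toℕ (L t)) (≺-disjoint {h = h} block hs≢0 t≢s))))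
    where
    vanish : ∀ {a} l → a ≡ 0 → a ∸ l ≡ 0
    vanish l refl = 0∸n≡0 l
    left : sumFin (λ j → fun (h (i j)) x ∸ l j) ≡ fun (h s) x ∸ (k ∸ toℕ (L s))
    left = by-cases (hit? s)
      where
      by-cases : Dec (∃[ j ] i j ≡ s) → sumFin (λ j → fun (h (i j)) x ∸ l j) ≡ fun (h s) x ∸ (k ∸ toℕ (L s))
      by-cases (yes (j , refl)) = trans
          (Σ-single _ j (λ j′ j′≢j → vanish (l j′) (≺-disjoint {h = h} block hs≢0 (j′≢j ∘ i-injective))))
          (trans (∸-∸-cap (l j) (FIN.bounded (h (i j)) x)) (cong (λ d → fun (h (i j)) x ∸ (k ∸ d)) (sym (L-hit j))))
      by-cases (no miss) = trans
          (Σ-zero _ (λ j → vanish (l j) (≺-disjoint {h = h} block hs≢0 (λ eq → miss (j , eq)))))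
          (sym (trans (cong (λ d → fun (h s) x ∸ (k ∸ d)) (L-miss s (λ j eq → miss (j , eq))))
                      (m≤n⇒m∸n≡0 (FIN.bounded (h s) x))))

-- From words to finitely supported functions

at : Word → ℕ → ℕ
at []      _       = 0
at (a ∷ w) zero    = a
at (a ∷ w) (suc x) = at w x

at-bounded : ∀ {k w} → Bounded k w → ∀ x → at w x ≤ k
at-bounded []       x       = z≤n
at-bounded (p ∷ ps) zero    = p
at-bounded (p ∷ ps) (suc x) = at-bounded ps x

at-∈ : ∀ {k w} → k ∈ w → ∃[ x ] at w x ≡ k
at-∈ (here refl) = 0 , refl
at-∈ (there p)   = let x , eq = at-∈ p in suc x , eq

at-supp : ∀ w x → at w x ≢ 0 → x < length w
at-supp []      x       ne = contradiction refl ne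
at-supp (a ∷ w) zero    ne = s≤s z≤n
at-supp (a ∷ w) (suc x) ne = s≤s (at-supp w x ne)

toFIN : ∀ {k n} w → FINWord k w → length w ≤ n → FINBelow k n
toFIN w (bw , k∈w) len = record
  { fun = at w ; bounded = at-bounded bw ; attains = at-∈ k∈w ; finSupp = length w , at-supp w } ,
  λ x ne → ≤-trans (at-supp w x ne) len

module _ {k n r : ℕ} (c : Coloring k n (suc r)) where

  FINWord? : ∀ w → Dec (FINWord k w × length w ≤ n)
  FINWord? w = (All.all? (_≤? k) w ×-dec Any.any? (k ≟_) w) ×-dec (length w ≤? n)

  private
    colour : ∀ w → Dec (FINWord k w × length w ≤ n) → Fin (suc r)
    colour w (yes (fw , len)) = c ⟨$⟩ toFIN w fw len
    -- An arbitrary colour for words that represent no element of FIN_k(n); it needs a nonempty set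
    -- of colours.
    colour w (no _)           = Fin.zero

  wordColouring : Colouring (suc r)
  wordColouring w = colour w (FINWord? w)

  wordColouring-spec : ∀ (h : FINBelow k n) w → FINWord k w → length w ≤ n → fun (proj₁ h) ≗ at w →
                       c ⟨$⟩ h ≡ wordColouring w
  wordColouring-spec h w fw len h≗ = go (FINWord? w)
    where
    go : ∀ d → c ⟨$⟩ h ≡ colour w d
    go (yes (fw′ , len′)) = Func.cong c h≗
    go (no ¬p)            = contradiction (fw , len) ¬p

shift : ℕ → Word → Word
shift o w = replicate o 0 ++ w

blockWord : ℕ → (V : List Word) → Fin (length V) → Word
blockWord o (w ∷ V) Fin.zero    = shift o w
blockWord o (w ∷ V) (Fin.suc i) = blockWord (o + length w) V i

at-shift-≥ : ∀ o w x → at (shift o w) x ≢ 0 → o ≤ x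
at-shift-≥ zero    w x       ne = z≤n
at-shift-≥ (suc o) w zero    ne = contradiction refl ne
at-shift-≥ (suc o) w (suc x) ne = s≤s (at-shift-≥ o w x ne)

length-shift : ∀ o w → length (shift o w) ≡ o + length w
length-shift o w = trans (length-++ (replicate o 0)) (cong (_+ length w) (length-replicate o))

blockWord-≥ : ∀ o V i {x} → at (blockWord o V i) x ≢ 0 → o ≤ x
blockWord-≥ o (w ∷ V) Fin.zero    ne = at-shift-≥ o w _ ne
blockWord-≥ o (w ∷ V) (Fin.suc i) ne = ≤-trans (m≤m+n o (length w)) (blockWord-≥ (o + length w) V i ne)

length-blockWord : ∀ o V i → length (blockWord o V i) ≤ o + width V
length-blockWord o (w ∷ V) Fin.zero    =
  ≤-trans (≤-reflexive (length-shift o w)) (+-monoʳ-≤ o (m≤m+n (length w) (width V)))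
length-blockWord o (w ∷ V) (Fin.suc i) =
  ≤-trans (length-blockWord (o + length w) V i) (≤-reflexive (+-assoc o (length w) (width V)))

blockWord-< : ∀ o V {i j} → i Fin.< j → ∀ x y →
              at (blockWord o V i) x ≢ 0 → at (blockWord o V j) y ≢ 0 → x < y
blockWord-< o (w ∷ V) {Fin.zero}  {Fin.suc j} _         x y nx ny =
  ≤-trans (subst (x <_) (length-shift o w) (at-supp (shift o w) x nx)) (blockWord-≥ (o + length w) V j ny)
blockWord-< o (w ∷ V) {Fin.suc i} {Fin.suc j} (s≤s i<j) x y nx ny = blockWord-< (o + length w) V i<j x y nx ny

blockWord-FINWord : ∀ {k} o V → All (FINWord k) V → ∀ i → FINWord k (blockWord o V i)
blockWord-FINWord o (w ∷ V) ((bw , k∈w) ∷ fV) Fin.zero =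
  All.++⁺ (All.replicate⁺ o z≤n) bw , ∈-++⁺ʳ (replicate o 0) k∈w
blockWord-FINWord o (w ∷ V) (_ ∷ fV) (Fin.suc i) = blockWord-FINWord (o + length w) V fV i

at-shift-++ : ∀ o d w v x →
  (at (shift o w) x ∸ d) + at (shift (o + length w) v) x ≡ at (shift o (map (_∸ d) w ++ v)) x
at-shift-++ zero    d []      v x       = cong (_+ at v x) (0∸n≡0 d)
at-shift-++ zero    d (a ∷ w) v zero    = +-identityʳ (a ∸ d)
at-shift-++ zero    d (a ∷ w) v (suc x) = at-shift-++ zero d w v x
at-shift-++ (suc o) d w       v zero    = cong (_+ 0) (0∸n≡0 d)
at-shift-++ (suc o) d w       v (suc x) = at-shift-++ o d w v x

-- Translates pointwise sums of scaled blocks into concatenation: each block begins where the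
-- previous one ends, so the summands never overlap.
Σ-blockWord : ∀ k o V (L : Fin (length V) → ℕ) x →
  sumFin (λ s → at (blockWord o V s) x ∸ (k ∸ L s)) ≡ at (shift o (sub k V (tabulate L))) x
Σ-blockWord k o []      L x = sym (at-zeros o x)
  where
  at-zeros : ∀ o x → at (shift o []) x ≡ 0
  at-zeros zero    x       = refl
  at-zeros (suc o) zero    = refl
  at-zeros (suc o) (suc x) = at-zeros o x
Σ-blockWord k o (w ∷ V) L x = trans
  (cong ((at (shift o w) x ∸ (k ∸ L Fin.zero)) +_) (Σ-blockWord k (o + length w) V (L ∘ Fin.suc) x))
  (at-shift-++ o (k ∸ L Fin.zero) w (sub k V (tabulate (L ∘ Fin.suc))) x)

gowers⇒homogeneous : ∀ {k m r n} → Gowers k m (suc r) n → Homogeneous k m (suc r) n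
gowers⇒homogeneous {k} {n = n} g c with V , system refl refl fV , hV ← g (wordColouring c) =
  h , (λ {i} {j} i<j → blockWord-< 0 V i<j) , constant
  where
  h : Fin (length V) → FINBelow k n
  h i = toFIN (blockWord 0 V i) (blockWord-FINWord 0 V fV i) (length-blockWord 0 V i)

  block : IsBlockSequence (proj₁ ∘ h)
  block i<j = blockWord-< 0 V i<j

  levels : (Fin (length V) → Fin (suc k)) → Word
  levels L = tabulate (toℕ ∘ L)

  levels-FINWord : ∀ L → (∃[ s ] toℕ (L s) ≡ k) → FINWord k (levels L)
  levels-FINWord L (s , Ls≡k) = All.tabulate⁺ (toℕ≤pred[n] ∘ L) , AnyP.tabulate⁺ s (sym Ls≡k)

  colour-normal : ∀ u L → (∃[ s ] toℕ (L s) ≡ k) →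
    fun (proj₁ u) ≗ (λ x → sumFin (λ s → at (blockWord 0 V s) x ∸ (k ∸ toℕ (L s)))) →
    c ⟨$⟩ u ≡ wordColouring c (sub k V (levels L))
  colour-normal u L top u≗ = wordColouring-spec c u (sub k V (levels L))
    (FINWord-closed fV (length-tabulate _) (levels-FINWord L top))
    (≤-reflexive (length-sub k V (levels L) (length-tabulate _)))
    (λ x → trans (u≗ x) (Σ-blockWord k 0 V (toℕ ∘ L) x))

  constant : ConstantOnSpace c (proj₁ ∘ h)
  constant u v u∈ v∈
    with L , Ltop , u≗ ← space⇒normal (proj₁ ∘ h) block u∈
       | L′ , L′top , v≗ ← space⇒normal (proj₁ ∘ h) block v∈ =
    trans (colour-normal u L Ltop u≗) (trans
      (hV (length-tabulate _) (length-tabulate _) (levels-FINWord L Ltop) (levels-FINWord L′ L′top))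
      (sym (colour-normal v L′ L′top v≗)))

-- Homogeneity is decidable

-- The types to be searched consist of functions and proofs and are finite only up to `_~_`, so just
-- those predicates that respect the relation are decided.
Searchable : {A : Set} → (A → A → Set) → Set₁
Searchable {A} _~_ = ∀ {P : A → Set} → (∀ {a b} → a ~ b → P a → P b) → (∀ a → Dec (P a)) → Dec (∃ P)

search-∀ : ∀ {A : Set} {_~_ : A → A → Set} → (∀ {a b} → a ~ b → b ~ a) → Searchable _~_ →
  ∀ {P : A → Set} → (∀ {a b} → a ~ b → P a → P b) → (∀ a → Dec (P a)) → Dec (∀ a → P a)
search-∀ ~-sym search resp P? with search (λ a~b ¬Pa Pb → ¬Pa (resp (~-sym a~b) Pb)) (λ a → ¬? (P? a))
... | yes (a , ¬Pa) = no (λ all → ¬Pa (all a))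
... | no none       = yes (λ a → decidable-stable (P? a) (λ ¬Pa → none (a , ¬Pa)))

search-Fin : ∀ {n} → Searchable {Fin n} _≡_
search-Fin _ = any?

Pointwise : ∀ {A : Set} {m} → (A → A → Set) → (Fin m → A) → (Fin m → A) → Set
Pointwise _~_ g h = ∀ i → g i ~ h i

search-→ : ∀ {A : Set} {_~_ : A → A → Set} → (∀ {a} → a ~ a) → Searchable _~_ → ∀ m → Searchable (Pointwise {m = m} _~_)
search-→ ~-refl search zero    resp P? = map′ (λ p → _ , p) (λ (_ , p) → resp (λ ()) p) (P? (λ ()))
search-→ {A} {_~_} ~-refl search (suc m) {P} resp P? =
  map′ (λ (a , g , p) → cons a g , p)
       (λ (h , p) → h Fin.zero , h ∘ Fin.suc , resp (λ { Fin.zero → ~-refl ; (Fin.suc i) → ~-refl }) p)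
       (search (λ a~b (g , p) → g , resp (λ { Fin.zero → a~b ; (Fin.suc i) → ~-refl }) p)
         λ a → search-→ ~-refl search m (λ g~h → resp λ { Fin.zero → ~-refl ; (Fin.suc i) → g~h i }) (λ g → P? (cons a g)))
  where
  cons : A → (Fin m → A) → Fin (suc m) → A
  cons a g Fin.zero    = a
  cons a g (Fin.suc i) = g i

funToFin-cong : ∀ {m n} {g h : Fin m → Fin n} → g ≗ h → funToFin g ≡ funToFin h
funToFin-cong {zero}  eq = refl
funToFin-cong {suc m} eq = cong₂ Fin.combine (eq Fin.zero) (funToFin-cong (eq ∘ Fin.suc))

module _ (k n : ℕ) where

  _≈_ : FINBelow k n → FINBelow k n → Set
  g ≈ h = fun (proj₁ g) ≗ fun (proj₁ h)

  Code : Set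
  Code = Fin (suc k ^ n)

  value : Code → ℕ → ℕ
  value e x with x <? n
  ... | yes x<n = toℕ (finToFun {suc k} {n} e (fromℕ< x<n))
  ... | no _    = 0

  value-≤ : ∀ e x → value e x ≤ k
  value-≤ e x with x <? n
  ... | yes x<n = toℕ≤pred[n] (finToFun {suc k} {n} e (fromℕ< x<n))
  ... | no _    = z≤n

  value-< : ∀ e x → value e x ≢ 0 → x < n
  value-< e x ne with x <? n
  ... | yes x<n = x<n
  ... | no _    = contradiction refl ne

  Attains : Code → Set
  Attains e = ∃[ x ] value e (toℕ {n} x) ≡ k

  decode : ∀ e → Attains e → FINBelow k n
  decode e (x , eq) = record { fun = value e ; bounded = value-≤ e ; attains = toℕ x , eq ; finSupp = n , value-< e } , value-< e

  digits : FINBelow k n → Fin n → Fin (suc k)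
  digits h i = fromℕ< (s≤s (FIN.bounded (proj₁ h) (toℕ i)))

  encode : FINBelow k n → Code
  encode h = funToFin (digits h)

  encode-cong : ∀ {g h} → g ≈ h → encode g ≡ encode h
  encode-cong {g} {h} g≈h = funToFin-cong {g = digits g} {digits h} (λ i → Fin.fromℕ<-cong _ _ (g≈h (toℕ i)) _ _)

  value-encode : ∀ h → fun (proj₁ h) ≗ value (encode h)
  value-encode h x with x <? n
  ... | yes x<n = sym (trans (cong toℕ (finToFun-funToFin (digits h) (fromℕ< x<n)))
                    (trans (toℕ-fromℕ< _) (cong (fun (proj₁ h)) (toℕ-fromℕ< x<n))))
  ... | no x≮n  = decidable-stable (fun (proj₁ h) x ≟ 0) (λ ne → x≮n (proj₂ h x ne))

  module _ (0<k : 0 < k) where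

    encode-attains : ∀ h → Attains (encode h)
    encode-attains h with FIN.attains (proj₁ h)
    ... | x , eq = fromℕ< x<n , trans (cong (value (encode h)) (toℕ-fromℕ< x<n)) (trans (sym (value-encode h x)) eq)
      where
      x<n : x < n
      -- A point with value k lies in the support because k is positive, so the search for it can
      -- stop at n.
      x<n = proj₂ h x (λ z → <⇒≢ 0<k (trans (sym z) eq))

    search-FINBelow : Searchable _≈_
    search-FINBelow {P} resp P? =
      map′ (λ (e , a , p) → decode e a , p)
           (λ (h , p) → encode h , encode-attains h , resp {h} {decode (encode h) (encode-attains h)} (value-encode h) p)
           (any? λ e → attaining e (any? (λ x → value e (toℕ x) ≟ k)))
      where
      attaining : ∀ e → Dec (Attains e) → Dec (Σ[ a ∈ Attains e ] P (decode e a))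
      attaining e (yes a) = map′ (a ,_) (λ (a′ , p) → resp {decode e a′} {decode e a} (λ _ → refl) p) (P? (decode e a))
      attaining e (no ¬a) = no (λ (a , _) → ¬a a)

    search-Coloring : ∀ r → Searchable {Coloring k n (suc r)} (λ c d → ∀ h → c ⟨$⟩ h ≡ d ⟨$⟩ h)
    search-Coloring r {P} resp P? =
      map′ (λ (C , p) → decodeC C , p)
           (λ (c , p) → encodeC c , resp {c} {decodeC (encodeC c)} (λ h → sym (encode-decode c h (any? _))) p)
           (search-→ refl search-Fin (suc k ^ n) (λ C≗D → resp (λ h → C≗D (encode h))) (λ C → P? (decodeC C)))
      where
      decodeC : (Code → Fin (suc r)) → Coloring k n (suc r)
      decodeC C = record { to = C ∘ encode ; cong = λ {g} {h} g≈h → cong C (encode-cong {g} {h} g≈h) }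

      colour : Coloring k n (suc r) → ∀ e → Dec (Attains e) → Fin (suc r)
      colour c e (yes a) = c ⟨$⟩ decode e a
      -- A code that never takes the value k decodes to no element; no `encode h` is of this kind.
      colour c e (no _)  = Fin.zero

      encodeC : Coloring k n (suc r) → Code → Fin (suc r)
      encodeC c e = colour c e (any? (λ x → value e (toℕ x) ≟ k))

      encode-decode : ∀ c h d → colour c (encode h) d ≡ c ⟨$⟩ h
      encode-decode c h (yes a) = Func.cong c (λ x → sym (value-encode h x))
      encode-decode c h (no ¬a) = contradiction (encode-attains h) ¬a

  module _ {m : ℕ} (h : Fin m → FINBelow k n) where

    private
      h₁ : Fin m → FIN k
      h₁ = proj₁ ∘ h

    block? : Dec (IsBlockSequence h₁)
    block? = map′
      (λ all {s} {t} s<t x y nx ny → subst₂ _<_ (toℕ-fromℕ< (proj₂ (h s) x nx)) (toℕ-fromℕ< (proj₂ (h t) y ny))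
        (all s t s<t (fromℕ< (proj₂ (h s) x nx)) (fromℕ< (proj₂ (h t) y ny))
          (λ z → nx (trans (cong (fun (h₁ s)) (sym (toℕ-fromℕ< _))) z)) (λ z → ny (trans (cong (fun (h₁ t)) (sym (toℕ-fromℕ< _))) z))))
      (λ block s t s<t x y nx ny → block s<t (toℕ x) (toℕ y) nx ny)
      (all? λ s → all? λ t → s Fin.<? t →-dec all? λ (x : Fin n) → all? λ (y : Fin n) →
        ¬? (fun (h₁ s) (toℕ x) ≟ 0) →-dec (¬? (fun (h₁ t) (toℕ y) ≟ 0) →-dec toℕ x <? toℕ y))

    normalSpace? : ∀ (u : FINBelow k n) → Dec (NormalSpace h₁ (fun (proj₁ u)))
    normalSpace? u = search-→ refl search-Fin m resp
      (λ L → any? (λ s → toℕ (L s) ≟ k) ×-dec pointwise? L)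
      where
      value-at : (Fin m → Fin (suc k)) → ℕ → ℕ
      value-at L x = sumFin (λ s → fun (h₁ s) x ∸ (k ∸ toℕ (L s)))

      resp : ∀ {L L′ : Fin m → Fin (suc k)} → L ≗ L′ →
        (∃[ s ] toℕ (L s) ≡ k) × fun (proj₁ u) ≗ value-at L → (∃[ s ] toℕ (L′ s) ≡ k) × fun (proj₁ u) ≗ value-at L′
      resp L≗L′ ((s , top) , u≗) = (s , trans (cong toℕ (sym (L≗L′ s))) top) ,
        λ x → trans (u≗ x) (sum-cong-≗ +-0-commutativeMonoid (λ s → cong (λ l → fun (h₁ s) x ∸ (k ∸ toℕ l)) (L≗L′ s)))

      pointwise? : ∀ L → Dec (fun (proj₁ u) ≗ value-at L)
      pointwise? L = map′ extend (λ u≗ x → u≗ (toℕ x)) (all? λ (x : Fin n) → fun (proj₁ u) (toℕ x) ≟ value-at L (toℕ x))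
        where
        extend : (∀ (x : Fin n) → fun (proj₁ u) (toℕ x) ≡ value-at L (toℕ x)) → fun (proj₁ u) ≗ value-at L
        extend all x with x <? n
        ... | yes x<n = subst (λ x → fun (proj₁ u) x ≡ value-at L x) (toℕ-fromℕ< x<n) (all (fromℕ< x<n))
        ... | no x≮n  = trans (outside u) (sym (Σ-zero _ λ s → trans (cong (_∸ (k ∸ toℕ (L s))) (outside (h s))) (0∸n≡0 (k ∸ toℕ (L s)))))
          where
          outside : ∀ (g : FINBelow k n) → fun (proj₁ g) x ≡ 0
          outside g = decidable-stable (fun (proj₁ g) x ≟ 0) (λ ne → x≮n (proj₂ g x ne))

    -- Membership is decided through the finitely many level vectors. The passage to them uses
    -- disjointness of the blocks, so `homogeneous?` tests the block condition before constancy.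
    space? : IsBlockSequence h₁ → ∀ (u : FINBelow k n) → Dec (Space h₁ (fun (proj₁ u)))
    space? block u = map′ (normal⇒space h₁) (space⇒normal h₁ block) (normalSpace? u)

    Space-resp : ∀ {u v : ℕ → ℕ} → u ≗ v → Space h₁ u → Space h₁ v
    Space-resp u≗v (p , i , l , 1≤p , mono , top , u≗) = p , i , l , 1≤p , mono , top , λ x → trans (sym (u≗v x)) (u≗ x)

    constant? : 0 < k → ∀ {r} (c : Coloring k n r) → IsBlockSequence h₁ → Dec (ConstantOnSpace c h₁)
    constant? 0<k c block =
      search-∀ (λ g≈h x → sym (g≈h x)) (search-FINBelow 0<k)
        (λ {u} {u′} u≈u′ const v u∈ v∈ → trans (sym (Func.cong c u≈u′)) (const v (Space-resp (λ x → sym (u≈u′ x)) u∈) v∈))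
        λ u → search-∀ (λ g≈h x → sym (g≈h x)) (search-FINBelow 0<k)
          (λ {v} {v′} v≈v′ const u∈ v∈ → trans (const u∈ (Space-resp (λ x → sym (v≈v′ x)) v∈)) (Func.cong c v≈v′))
          λ v → space? block u →-dec (space? block v →-dec (c ⟨$⟩ u Fin.≟ c ⟨$⟩ v))

  homogeneous? : 0 < k → ∀ m r → Dec (Homogeneous k m (suc r) n)
  homogeneous? 0<k m r = search-∀ (λ c≈d h → sym (c≈d h)) (search-Coloring 0<k r)
    (λ {c} {d} c≈d (h , block , const) → h , block , λ u v u∈ v∈ → trans (sym (c≈d u)) (trans (const u v u∈ v∈) (c≈d v)))
    λ c → search-→ {_~_ = _≈_} (λ {_} _ → refl) (search-FINBelow 0<k) m (λ {h} {g} → resp c {h} {g}) (λ h → both c h (block? h))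
    where
    both : ∀ c h → Dec (IsBlockSequence (proj₁ ∘ h)) → Dec (IsBlockSequence (proj₁ ∘ h) × ConstantOnSpace c (proj₁ ∘ h))
    both c h (yes block) = map′ (block ,_) proj₂ (constant? h 0<k c block)
    both c h (no ¬block) = no (¬block ∘ proj₁)

    transfer : ∀ {h g : Fin m → FINBelow k n} → (∀ i → h i ≈ g i) → ∀ {u} → Space (proj₁ ∘ g) u → Space (proj₁ ∘ h) u
    transfer {h} {g} h≈g (p , i , l , 1≤p , mono , top , u≗) = p , i , l , 1≤p , mono , top ,
      λ x → trans (u≗ x) (sum-cong-≗ +-0-commutativeMonoid λ j →
        trans (iterate-T (fun (proj₁ (g (i j)))) (l j) x) (trans (cong (_∸ l j) (sym (h≈g (i j) x))) (sym (iterate-T (fun (proj₁ (h (i j)))) (l j) x))))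

    resp : ∀ c {h g : Fin m → FINBelow k n} → (∀ i → h i ≈ g i) →
      IsBlockSequence (proj₁ ∘ h) × ConstantOnSpace c (proj₁ ∘ h) → IsBlockSequence (proj₁ ∘ g) × ConstantOnSpace c (proj₁ ∘ g)
    resp c {h} {g} h≈g (block , const) =
      (λ {s} {t} s<t x y nx ny → block s<t x y (λ z → nx (trans (sym (h≈g s x)) z)) (λ z → ny (trans (sym (h≈g t y)) z))) ,
      λ u v u∈ v∈ → const u v (transfer {h} {g} h≈g u∈) (transfer {h} {g} h≈g v∈)

least : ∀ {P : ℕ → Set} → (∀ n → Dec (P n)) → ∀ N → P N → ∃[ n ] IsLeast P n × n ≤ N
least {P} P? N PN = go 0 N (λ _ ()) (+-comm N 0)
  where
  go : ∀ n d → (∀ n′ → n′ < n → ¬ P n′) → d + n ≡ N → ∃[ n ] IsLeast P n × n ≤ N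
  go n d below eq with P? n
  ... | yes Pn = n , (Pn , λ n′ Pn′ → ≮⇒≥ (λ n′<n → below n′ n′<n Pn′)) , subst (n ≤_) eq (m≤n+m n d)
  go n zero    below refl | no ¬Pn = contradiction PN ¬Pn
  go n (suc d) below eq   | no ¬Pn = go (suc n) d
    (λ n′ n′<1+n Pn′ → [ (λ n′<n → below n′ n′<n Pn′) , (λ { refl → ¬Pn Pn′ }) ]′ (m≤n⇒m<n∨m≡n (s≤s⁻¹ n′<1+n)))
    (trans (+-suc d n) eq)

-- The Ackermann hierarchy and the bounds

iterate-+ : ∀ {A : Set} (g : A → A) x m n → iterate g x (m + n) ≡ iterate g (iterate g x m) n
iterate-+ g x zero    n = refl
iterate-+ g x (suc m) n = iterate-+ g (g x) m n

iterate-suc : ∀ {A : Set} (g : A → A) x n → iterate g x (suc n) ≡ g (iterate g x n)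
iterate-suc g x zero    = refl
iterate-suc g x (suc n) = iterate-suc g (g x) n

≤-from : ∀ {m n} o → m + o ≡ n → m ≤ n
≤-from {m} o eq = subst (m ≤_) eq (m≤m+n m o)

n<2^n : ∀ n → n < 2 ^ n
n<2^n zero    = s≤s z≤n
n<2^n (suc n) = ≤-trans (≤-reflexive (sym (+-comm (suc n) 1)))
                  (≤-trans (+-mono-≤ (n<2^n n) (≤-trans (s≤s z≤n) (n<2^n n))) (≤-reflexive (cong (2 ^ n +_) (sym (+-identityʳ (2 ^ n))))))

n+n≤2^n : ∀ n → n + n ≤ 2 ^ n
n+n≤2^n zero    = z≤n
n+n≤2^n (suc n) = ≤-trans (+-mono-≤ (n<2^n n) (n<2^n n)) (≤-reflexive (cong (2 ^ n +_) (sym (+-identityʳ (2 ^ n)))))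

-- The level f₁ is left out because f₁ 0 = 0 breaks n < f n.
opaque
  F : ℕ → ℕ → ℕ
  F i = f (2 + i)

  F≡f : ∀ i x → F i x ≡ f (2 + i) x
  F≡f i x = refl

  F₀≡2^ : ∀ x → F 0 x ≡ 2 ^ x
  F₀≡2^ zero    = refl
  F₀≡2^ (suc x) = trans (iterate-suc (f 1) 1 x) (cong (2 *_) (F₀≡2^ x))

  F-zero : ∀ i → F i 0 ≡ 1
  F-zero i = refl

  -- Here f₄(3) = 65536, and 224 = 32 · (2 + 5) is the starting value that `headLength≤F` requires
  -- for two colours.
  224≤F : 224 ≤ F 2 3
  224≤F = m≤m+n 224 65312

  F-iterate : ∀ i x → F (suc i) x ≡ iterate (F i) 1 x
  F-iterate i x = refl

F-suc : ∀ i x → F (suc i) (suc x) ≡ F i (F (suc i) x)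
F-suc i x = trans (F-iterate i (suc x)) (trans (iterate-suc (F i) 1 x) (cong (F i) (sym (F-iterate i x))))

n<F : ∀ i n → n < F i n
n<F zero    n       = subst (n <_) (sym (F₀≡2^ n)) (n<2^n n)
n<F (suc i) zero    = ≤-reflexive (sym (F-zero (suc i)))
n<F (suc i) (suc n) = ≤-trans (s≤s (n<F (suc i) n)) (≤-trans (n<F i (F (suc i) n)) (≤-reflexive (sym (F-suc i n))))

n≤F : ∀ i n → n ≤ F i n
n≤F i n = <⇒≤ (n<F i n)

F-mono : ∀ i {x y} → x ≤ y → F i x ≤ F i y
F-mono i x≤y = go (≤⇒≤′ x≤y)
  where
  step : ∀ i y → F i y ≤ F i (suc y)
  step zero    y = subst₂ _≤_ (sym (F₀≡2^ y)) (sym (F₀≡2^ (suc y))) (m≤m+n (2 ^ y) _)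
  step (suc i) y = ≤-trans (n≤F i (F (suc i) y)) (≤-reflexive (sym (F-suc i y)))
  go : ∀ {x y} → x ≤′ y → F i x ≤ F i y
  go ≤′-refl             = ≤-refl
  go (≤′-step {y} x≤′y)  = ≤-trans (go x≤′y) (step i y)

F-level : ∀ i x → F i x ≤ F (suc i) x
F-level i       zero    = ≤-reflexive (trans (F-zero i) (sym (F-zero (suc i))))
F-level i       (suc x) = ≤-trans (F-mono i (n<F (suc i) x)) (≤-reflexive (sym (F-suc i x)))

2^≤F : ∀ i x → 2 ^ x ≤ F i x
2^≤F zero    x = ≤-reflexive (sym (F₀≡2^ x))
2^≤F (suc i) x = ≤-trans (2^≤F i x) (F-level i x)

n+n≤F : ∀ i n → n + n ≤ F i n
n+n≤F i n = ≤-trans (n+n≤2^n n) (2^≤F i n)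

-- Growth in the index, used to absorb `j` in `gowers₂≤F`. The argument starts at 3 because F i 2 =
-- 4 for every i.
i+n≤F : ∀ i n → i + (3 + n) ≤ F i (3 + n)
i+n≤F zero    n = n≤F 0 (3 + n)
i+n≤F (suc i) n = begin
  suc i + (3 + n)         ≡⟨ +-suc i (3 + n) ⟨
  i + (3 + suc n)         ≤⟨ i+n≤F i (suc n) ⟩
  F i (3 + suc n)         ≤⟨ F-mono i (≤-trans (≤-from n (solve 1 (λ n → con 4 :+ n :+ n := (con 2 :+ n) :+ (con 2 :+ n)) refl n)) (n+n≤F (suc i) (2 + n))) ⟩
  F i (F (suc i) (2 + n)) ≡⟨ F-suc i (2 + n) ⟨
  F (suc i) (3 + n)       ∎
  where open ≤-Reasoning

-- Arithmetic of iterates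

It : ℕ → ℕ → ℕ → ℕ
It i q x = iterate (F i) x q

It-≥ : ∀ i q x → x ≤ It i q x
It-≥ i zero    x = ≤-refl
It-≥ i (suc q) x = ≤-trans (n≤F i x) (It-≥ i q (F i x))

It-mono : ∀ i q {x y} → x ≤ y → It i q x ≤ It i q y
It-mono i zero    x≤y = x≤y
It-mono i (suc q) x≤y = It-mono i q (F-mono i x≤y)

It-monoᵉ : ∀ i p q x → p ≤ q → It i p x ≤ It i q x
It-monoᵉ i p q x p≤q = begin
  It i p x              ≤⟨ It-≥ i (q ∸ p) (It i p x) ⟩
  It i (q ∸ p) (It i p x) ≡⟨ iterate-+ (F i) x p (q ∸ p) ⟨
  It i (p + (q ∸ p)) x  ≡⟨ cong (λ q → It i q x) (m+[n∸m]≡n p≤q) ⟩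
  It i q x              ∎
  where open ≤-Reasoning

It-level : ∀ {i i′} q x → i ≤ i′ → It i q x ≤ It i′ q x
It-level {i} q x i≤i′ = go (≤⇒≤′ i≤i′)
  where
  step : ∀ i q x → It i q x ≤ It (suc i) q x
  step i zero    x = ≤-refl
  step i (suc q) x = ≤-trans (step i q (F i x)) (It-mono (suc i) q (F-level i x))
  go : ∀ {i′} → i ≤′ i′ → It i q x ≤ It i′ q x
  go ≤′-refl            = ≤-refl
  go (≤′-step {i″} p)   = ≤-trans (go p) (step i″ q x)

-- One level up, q further applications of `F i` cost only the addition of q to the argument. All
-- constant factors are absorbed this way.
It-F : ∀ i q x → It i q (F (suc i) x) ≡ F (suc i) (x + q)
It-F i q x = trans (cong (It i q) (F-iterate i x)) (trans (sym (iterate-+ (F i) 1 x q)) (sym (F-iterate i (x + q))))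

2^*≤It : ∀ i t x → 2 ^ t * x ≤ It i t x
2^*≤It i zero    x = ≤-reflexive (+-identityʳ x)
2^*≤It i (suc t) x = begin
  2 * 2 ^ t * x       ≡⟨ solve 2 (λ a x → con 2 :* a :* x := a :* (x :+ x)) refl (2 ^ t) x ⟩
  2 ^ t * (x + x)     ≤⟨ *-monoʳ-≤ (2 ^ t) (n+n≤F i x) ⟩
  2 ^ t * F i x       ≤⟨ 2^*≤It i t (F i x) ⟩
  It i t (F i x)      ∎
  where open ≤-Reasoning

n*n≤2^2^n : ∀ n → n * n ≤ 2 ^ (2 ^ n)
n*n≤2^2^n n = begin
  n * n           ≤⟨ *-mono-≤ (<⇒≤ (n<2^n n)) (<⇒≤ (n<2^n n)) ⟩
  2 ^ n * 2 ^ n   ≡⟨ ^-distribˡ-+-* 2 n n ⟨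
  2 ^ (n + n)     ≤⟨ ^-monoʳ-≤ 2 (n+n≤2^n n) ⟩
  2 ^ (2 ^ n)     ∎
  where open ≤-Reasoning

-- With x = r + c, three applications cover r^p ≤ x^x ≤ 2^(x·x) ≤ 2^(2^(2^x)), and the fourth covers
-- the sum with c.
pow≤It : ∀ i {r p c} → p ≤ r + c → 1 ≤ c → r ^ p + c ≤ It i 4 (r + c)
pow≤It i {r} {p} {c@(suc _)} p≤ _ = begin
  r ^ p + c                     ≤⟨ +-mono-≤ r^p≤ c≤ ⟩
  F i (F i (F i x)) + F i (F i (F i x)) ≤⟨ n+n≤F i (F i (F i (F i x))) ⟩
  F i (F i (F i (F i x)))       ∎
  where
  open ≤-Reasoning
  x = r + c
  instance
    x≢0 : NonZero x
    x≢0 = >-nonZero (≤-trans (s≤s z≤n) (m≤n+m c r))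
  c≤ : c ≤ F i (F i (F i x))
  c≤ = ≤-trans (m≤n+m c r) (It-≥ i 3 x)
  r^p≤ : r ^ p ≤ F i (F i (F i x))
  r^p≤ = begin
    r ^ p               ≤⟨ ^-monoˡ-≤ p (m≤m+n r c) ⟩
    x ^ p               ≤⟨ ^-monoʳ-≤ x p≤ ⟩
    x ^ x               ≤⟨ ^-monoˡ-≤ x (<⇒≤ (n<2^n x)) ⟩
    (2 ^ x) ^ x         ≡⟨ ^-*-assoc 2 x x ⟩
    2 ^ (x * x)         ≤⟨ ^-monoʳ-≤ 2 (n*n≤2^2^n x) ⟩
    2 ^ (2 ^ (2 ^ x))   ≤⟨ 2^≤F i (2 ^ (2 ^ x)) ⟩
    F i (2 ^ (2 ^ x))   ≤⟨ F-mono i (2^≤F i (2 ^ x)) ⟩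
    F i (F i (2 ^ x))   ≤⟨ F-mono i (F-mono i (2^≤F i x)) ⟩
    F i (F i (F i x))   ∎

module _ {k i e c : ℕ} {Y : ℕ → ℕ → ℕ} (1+k≤c : suc k ≤ c) (Y≤ : ∀ m r → Y m r ≤ It i e (m + r + c)) where

  -- A round costs 4 applications for the larger number of colours (`pow≤It`), 1 for the sum inside
  -- the argument of `Y`, and e for `Y` itself.
  Iter≤It : ∀ n r → Iter k Y n r ≤ It i (n * (5 + e)) (r + c)
  Iter≤It zero    r = z≤n
  Iter≤It (suc n) r = begin
    Y A r                         ≤⟨ Y≤ A r ⟩
    It i e (A + r + c)            ≡⟨ cong (It i e) (+-assoc A r c) ⟩
    It i e (A + x)                ≤⟨ It-mono i e (≤-trans (+-mono-≤ A≤B (It-≥ i (4 + n * (5 + e)) x)) (n+n≤F i B)) ⟩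
    It i (suc e) B                ≡⟨ iterate-+ (F i) x (4 + n * (5 + e)) (suc e) ⟨
    It i (4 + n * (5 + e) + suc e) x ≡⟨ cong (λ q → It i q x) (solve 2 (λ a e → con 4 :+ a :+ (con 1 :+ e) := con 5 :+ e :+ a) refl (n * (5 + e)) e) ⟩
    It i (suc n * (5 + e)) x      ∎
    where
    open ≤-Reasoning
    A = Iter k Y n (r ^ suc k)
    x = r + c
    B = It i (4 + n * (5 + e)) x
    A≤B : A ≤ B
    A≤B = begin
      A                                   ≤⟨ Iter≤It n (r ^ suc k) ⟩
      It i (n * (5 + e)) (r ^ suc k + c)  ≤⟨ It-mono i (n * (5 + e)) (pow≤It i (≤-trans 1+k≤c (m≤n+m c r)) (≤-trans (s≤s z≤n) 1+k≤c)) ⟩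
      It i (n * (5 + e)) (It i 4 x)       ≡⟨ iterate-+ (F i) x 4 (n * (5 + e)) ⟨
      B                                   ∎

  Iter≤F : ∀ n r → Iter k Y n r ≤ F (suc i) (r + c + n * (5 + e))
  Iter≤F n r = begin
    Iter k Y n r                                ≤⟨ Iter≤It n r ⟩
    It i (n * (5 + e)) (r + c)                  ≤⟨ It-mono i (n * (5 + e)) (n≤F (suc i) (r + c)) ⟩
    It i (n * (5 + e)) (F (suc i) (r + c))      ≡⟨ It-F i (n * (5 + e)) (r + c) ⟩
    F (suc i) (r + c + n * (5 + e))             ∎
    where open ≤-Reasoning

  -- Restores the shape of the hypothesis on `Y` one level higher, so that the second fusion can be
  -- estimated by the same lemmas. The factor 6 + e is rounded up to a power of 2, paid for by t
  -- applications.
  Iter-suc≤It : ∀ t → 6 + e ≤ 2 ^ t → ∀ m r → Iter k Y (suc m) r ≤ It (suc i) (suc t) (m + r + c)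
  Iter-suc≤It t 6+e≤ m r = begin
    Iter k Y (suc m) r                        ≤⟨ Iter≤F (suc m) r ⟩
    F (suc i) (r + c + suc m * (5 + e))       ≤⟨ F-mono (suc i) (+-mono-≤ {r + c} {x} (≤-trans (m≤n+m (r + c) m) (≤-reflexive (sym (+-assoc m r c)))) (*-monoˡ-≤ (5 + e) 1+m≤x)) ⟩
    F (suc i) (x + x * (5 + e))               ≡⟨ cong (F (suc i)) (solve 2 (λ x e → x :+ x :* (con 5 :+ e) := (con 6 :+ e) :* x) refl x e) ⟩
    F (suc i) ((6 + e) * x)                   ≤⟨ F-mono (suc i) (≤-trans (*-monoˡ-≤ x 6+e≤) (2^*≤It (suc i) t x)) ⟩
    F (suc i) (It (suc i) t x)                ≡⟨ iterate-suc (F (suc i)) x t ⟨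
    It (suc i) (suc t) x                      ∎
    where
    open ≤-Reasoning
    x = m + r + c
    1+m≤x : suc m ≤ x
    1+m≤x = ≤-trans (≤-reflexive (+-comm 1 m)) (+-mono-≤ (m≤m+n m r) (≤-trans (s≤s z≤n) 1+k≤c))

-- Bounds for Ramsey, Hilbert cubes, Folkman and finite unions

pigeonBound : ℕ → ℕ → ℕ
pigeonBound m r = suc (r * m)

-- A round squares the number of colours, so `B` is squared along with it and the result is doubly
-- exponential. The general estimate would already spend a level here; the factor `B` on the left
-- makes the induction close.
Iter-pigeon : ∀ n r B → 2 + r ≤ B → B * suc (Iter 1 pigeonBound n r) ≤ B ^ (2 ^ suc n)
Iter-pigeon zero    r B@(suc _) _     = *-monoʳ-≤ B (s≤s z≤n)
Iter-pigeon (suc n) r B         2+r≤B = begin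
  B * (2 + r * X)            ≤⟨ *-monoʳ-≤ B (≤-trans (≤-from {2 + r * X} (r + 2 * X)
                                  (solve 2 (λ r X → con 2 :+ r :* X :+ (r :+ con 2 :* X) := (con 2 :+ r) :* (con 1 :+ X)) refl r X)) (*-monoˡ-≤ (suc X) 2+r≤B)) ⟩
  B * (B * suc X)            ≡⟨ *-assoc B B (suc X) ⟨
  B * B * suc X              ≤⟨ Iter-pigeon n (r ^ 2) (B * B) (≤-trans (≤-from (2 + 4 * r)
                                  (solve 1 (λ r → con 2 :+ r :* (r :* con 1) :+ (con 2 :+ con 4 :* r) := (con 2 :+ r) :* (con 2 :+ r)) refl r)) (*-mono-≤ 2+r≤B 2+r≤B)) ⟩
  (B * B) ^ (2 ^ suc n)      ≡⟨ cong (λ b → (B * b) ^ (2 ^ suc n)) (*-identityʳ B) ⟨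
  (B ^ 2) ^ (2 ^ suc n)      ≡⟨ ^-*-assoc B 2 (2 ^ suc n) ⟩
  B ^ (2 ^ suc (suc n))      ∎
  where
  open ≤-Reasoning
  X = Iter 1 pigeonBound n (r ^ 2)

Iter-pigeon≤It : ∀ m r → Iter 1 pigeonBound (suc m) r ≤ It 0 2 (m + r + 4)
Iter-pigeon≤It m r = begin
  X                            ≤⟨ ≤-trans (n≤1+n X) (m≤n*m (suc X) B) ⟩
  B * suc X                    ≤⟨ Iter-pigeon (suc m) r B ≤-refl ⟩
  B ^ (2 ^ (2 + m))            ≤⟨ ^-monoˡ-≤ (2 ^ (2 + m)) (<⇒≤ (n<2^n B)) ⟩
  (2 ^ B) ^ (2 ^ (2 + m))      ≡⟨ ^-*-assoc 2 B (2 ^ (2 + m)) ⟩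
  2 ^ (B * 2 ^ (2 + m))        ≤⟨ ^-monoʳ-≤ 2 (*-monoˡ-≤ (2 ^ (2 + m)) (<⇒≤ (n<2^n B))) ⟩
  2 ^ (2 ^ B * 2 ^ (2 + m))    ≡⟨ cong (2 ^_) (^-distribˡ-+-* 2 B (2 + m)) ⟨
  2 ^ (2 ^ (B + (2 + m)))      ≡⟨ cong (λ x → 2 ^ (2 ^ x)) (solve 2 (λ m r → con 2 :+ r :+ (con 2 :+ m) := m :+ r :+ con 4) refl m r) ⟩
  2 ^ (2 ^ (m + r + 4))        ≤⟨ 2^≤F 0 (2 ^ (m + r + 4)) ⟩
  F 0 (2 ^ (m + r + 4))        ≤⟨ F-mono 0 (2^≤F 0 (m + r + 4)) ⟩
  It 0 2 (m + r + 4)           ∎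
  where
  open ≤-Reasoning
  B = 2 + r
  X = Iter 1 pigeonBound (suc m) r

ramsey≤F : ∀ n r → ramseyBound n r ≤ F 1 (r + 4 + n * 7)
ramsey≤F = Iter≤F {i = 0} {e = 2} (s≤s (s≤s z≤n)) Iter-pigeon≤It

-- Each direction costs 5 applications: 4 for the r^(r+1) colours and 1 for adding the r entries.
cube≤It : ∀ D r → cubeLength D r ≤ It 0 (D * 5) (r + 2)
cube≤It zero    r = ≤-trans (s≤s z≤n) (m≤n+m 2 r)
cube≤It (suc D) r = begin
  r + cubeLength D (r ^ suc r)                      ≤⟨ +-mono-≤ (≤-trans (m≤m+n r 2) (It-≥ 0 (4 + D * 5) (r + 2))) B≥ ⟩
  It 0 (4 + D * 5) (r + 2) + It 0 (4 + D * 5) (r + 2) ≤⟨ n+n≤F 0 (It 0 (4 + D * 5) (r + 2)) ⟩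
  F 0 (It 0 (4 + D * 5) (r + 2))                    ≡⟨ iterate-suc (F 0) (r + 2) (4 + D * 5) ⟨
  It 0 (suc D * 5) (r + 2)                          ∎
  where
  open ≤-Reasoning
  B≥ : cubeLength D (r ^ suc r) ≤ It 0 (4 + D * 5) (r + 2)
  B≥ = begin
    cubeLength D (r ^ suc r)            ≤⟨ cube≤It D (r ^ suc r) ⟩
    It 0 (D * 5) (r ^ suc r + 2)        ≤⟨ It-mono 0 (D * 5) (pow≤It 0 (≤-trans (≤-reflexive (+-comm 1 r)) (+-monoʳ-≤ r (s≤s z≤n))) (s≤s z≤n)) ⟩
    It 0 (D * 5) (It 0 4 (r + 2))       ≡⟨ iterate-+ (F 0) (r + 2) 4 (D * 5) ⟨
    It 0 (4 + D * 5) (r + 2)            ∎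

cube≤F : ∀ D r → cubeLength D r ≤ F 1 (r + 2 + D * 5)
cube≤F D r = begin
  cubeLength D r                ≤⟨ cube≤It D r ⟩
  It 0 (D * 5) (r + 2)          ≤⟨ It-mono 0 (D * 5) (n≤F 1 (r + 2)) ⟩
  It 0 (D * 5) (F 1 (r + 2))    ≡⟨ It-F 0 (D * 5) (r + 2) ⟩
  F 1 (r + 2 + D * 5)           ∎
  where open ≤-Reasoning

2^*F≤F : ∀ i t x → 2 ^ t * F (suc i) x ≤ F (suc i) (x + t)
2^*F≤F i t x = ≤-trans (2^*≤It i t (F (suc i) x)) (≤-reflexive (It-F i t x))

module _ {r t : ℕ} (start : 32 * (r + 5) ≤ F 2 t) where

  -- The factor 32 is carried along so that the next argument, linear in P with coefficient 5, fits
  -- below the inductive bound. Doubling `F 1 z` turns 32 into 64 = 2^6, which costs only 6 in the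
  -- argument of `F 1`.
  headLength≤F : ∀ i → 32 * (headLength r (suc i) + (r + 4)) ≤ F 2 (t + i)
  headLength≤F zero    = ≤-trans (≤-reflexive (cong (32 *_) (sym (+-suc r 4))))
                           (≤-trans start (≤-reflexive (cong (F 2) (sym (+-identityʳ t)))))
  headLength≤F (suc i) = begin
    32 * (headLength r (suc (suc i)) + (r + 4)) ≤⟨ *-monoʳ-≤ 32 (+-mono-≤ (≤-trans (cube≤F P r) (F-mono 1 (+-monoˡ-≤ (P * 5) (+-monoʳ-≤ r (s≤s (s≤s z≤n))))))
                                                      (≤-trans (m≤m+n (r + 4) (P * 5)) (n≤F 1 z))) ⟩
    32 * (F 1 z + F 1 z)          ≡⟨ solve 1 (λ y → con 32 :* (y :+ y) := con 64 :* y) refl (F 1 z) ⟩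
    64 * F 1 z                    ≤⟨ 2^*F≤F 0 6 z ⟩
    F 1 (z + 6)                   ≤⟨ F-mono 1 (≤-from (31 * r + 118 + P * 27)
                                       (solve 2 (λ P r → r :+ con 4 :+ P :* con 5 :+ con 6 :+ (con 31 :* r :+ con 118 :+ P :* con 27) := con 32 :* (P :+ (r :+ con 4))) refl P r)) ⟩
    F 1 (32 * (P + (r + 4)))      ≤⟨ F-mono 1 (headLength≤F i) ⟩
    F 1 (F 2 (t + i))             ≡⟨ F-suc 1 (t + i) ⟨
    F 2 (suc (t + i))             ≡⟨ cong (F 2) (+-suc t i) ⟨
    F 2 (t + suc i)               ∎
    where
    open ≤-Reasoning
    P = headLength r (suc i)
    z = r + 4 + P * 5

  64*[1+union]≤F : ∀ m → 64 * suc (unionBound m r) ≤ F 2 (suc (t + r * m))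
  64*[1+union]≤F m = begin
    -- The Ramsey bound is a single `F 1` applied to the Folkman bound, so it adds just one to the
    -- argument of `F 2`.
    64 * suc (unionBound m r)     ≤⟨ *-monoʳ-≤ 64 (+-mono-≤ (≤-trans (s≤s z≤n) (n<F 1 z)) (ramsey≤F P r)) ⟩
    64 * (F 1 z + F 1 z)          ≡⟨ solve 1 (λ y → con 64 :* (y :+ y) := con 128 :* y) refl (F 1 z) ⟩
    128 * F 1 z                   ≤⟨ 2^*F≤F 0 7 z ⟩
    F 1 (z + 7)                   ≤⟨ F-mono 1 (≤-from (31 * r + 117 + P * 25)
                                       (solve 2 (λ P r → r :+ con 4 :+ P :* con 7 :+ con 7 :+ (con 31 :* r :+ con 117 :+ P :* con 25) := con 32 :* (P :+ (r :+ con 4))) refl P r)) ⟩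
    F 1 (32 * (P + (r + 4)))      ≤⟨ F-mono 1 (headLength≤F (r * m)) ⟩
    F 1 (F 2 (t + r * m))         ≡⟨ F-suc 1 (t + r * m) ⟨
    F 2 (suc (t + r * m))         ∎
    where
    open ≤-Reasoning
    P = folkmanBound m r
    z = r + 4 + P * 7

union≤It : ∀ m r → unionBound m r ≤ It 2 9 (m + r + 4)
union≤It m r = begin
  unionBound m r                ≤⟨ ≤-trans (n≤1+n (unionBound m r)) (m≤n*m (suc (unionBound m r)) 64) ⟩
  64 * suc (unionBound m r)     ≤⟨ 64*[1+union]≤F {r} {32 * (r + 5)} (n≤F 2 (32 * (r + 5))) m ⟩
  F 2 (suc (32 * (r + 5) + r * m)) ≤⟨ F-mono 2 small ⟩
  F 2 (It 2 8 x)                ≡⟨ iterate-suc (F 2) x 8 ⟨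
  It 2 9 x                      ∎
  where
  open ≤-Reasoning
  x = m + r + 4
  square : x * x ≤ It 2 2 x
  square = ≤-trans (n*n≤2^2^n x) (≤-trans (2^≤F 2 (2 ^ x)) (F-mono 2 (2^≤F 2 x)))
  small : suc (32 * (r + 5) + r * m) ≤ It 2 8 x
  small = begin
    suc (32 * (r + 5) + r * m)      ≤⟨ ≤-from (95 + 32 * r + m * 72 + m * m + m * r + r * r + r * 8 + 16)
                                         (solve 2 (λ m r → con 1 :+ (con 32 :* (r :+ con 5) :+ r :* m) :+ (con 95 :+ con 32 :* r :+ m :* con 72 :+ m :* m :+ m :* r :+ r :* r :+ r :* con 8 :+ con 16)
                                            := con 64 :* (m :+ r :+ con 4) :+ (m :+ r :+ con 4) :* (m :+ r :+ con 4)) refl m r) ⟩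
    64 * x + x * x                  ≤⟨ +-mono-≤ (2^*≤It 2 6 x) (≤-trans square (It-monoᵉ 2 2 6 x (s≤s (s≤s z≤n)))) ⟩
    It 2 6 x + It 2 6 x             ≤⟨ n+n≤F 2 (It 2 6 x) ⟩
    F 2 (It 2 6 x)                  ≡⟨ iterate-suc (F 2) x 6 ⟨
    It 2 7 x                        ≤⟨ It-monoᵉ 2 7 8 x (n≤1+n 7) ⟩
    It 2 8 x                        ∎

-- Bounds for the induction on k

level : ℕ → ℕ
level zero    = 2
level (suc j) = 2 + level j

2≤level : ∀ j → 2 ≤ level j
2≤level zero    = ≤-refl
2≤level (suc j) = ≤-trans (2≤level j) (m≤n+m (level j) 2)

j≤level : ∀ j → j ≤ level j
j≤level zero    = z≤n
j≤level (suc j) = s≤s (m≤n⇒m≤1+n (j≤level j))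

innerBound : ℕ → ℕ → ℕ → ℕ
innerBound j m = Iter (2 + j) (gowersBound j) (suc m)

-- The constant 16 reproduces itself: the inner fusion needs 6 + 16 ≤ 2^5 and yields 6, a round of
-- the outer one costs 5 + 6 = 11, and with three blocks per triple 1 + 33 ≤ 2^6 yields 7
-- applications beyond the 9 that bound `unionBound`. The summand 4 + j dominates the colour
-- exponents 3 + j.
gowers≤It : ∀ j m r → gowersBound j m r ≤ It (level j) 16 (m + r + (4 + j))

inner≤It : ∀ j m r → innerBound j m r ≤ It (suc (level j)) 6 (m + r + (4 + j))
inner≤It j = Iter-suc≤It {k = 2 + j} {i = level j} {e = 16} (n≤1+n (3 + j)) (gowers≤It j) 5 (m≤m+n 22 10)

gowers≤It zero    m r = ≤-trans (union≤It m r) (It-monoᵉ 2 9 16 (m + r + 4) (m≤m+n 9 7))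
gowers≤It (suc j) m r = begin
  gowersBound (suc j) m r                ≤⟨ Iter≤F {i = suc (level j)} {e = 6} (n≤1+n (3 + j)) (inner≤It j) (u * 3) r ⟩
  F i (r + (4 + j) + u * 3 * 11)         ≤⟨ F-mono i (+-mono-≤ {r + (4 + j)} {B} (≤-trans (≤-trans (m≤n+m (r + (4 + j)) m)
                                              (≤-trans (≤-reflexive (sym (+-assoc m r (4 + j)))) (+-monoʳ-≤ (m + r) (n≤1+n (4 + j))))) (It-≥ i 9 x))
                                              (*-monoˡ-≤ 11 (*-monoˡ-≤ 3 u≤B))) ⟩
  F i (B + B * 3 * 11)                   ≤⟨ F-mono i (≤-from (B * 30) (solve 1 (λ B → B :+ B :* con 3 :* con 11 :+ B :* con 30 := con 64 :* B) refl B)) ⟩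
  F i (64 * B)                           ≤⟨ F-mono i (2^*≤It i 6 B) ⟩
  F i (It i 6 B)                         ≡⟨ iterate-suc (F i) B 6 ⟨
  It i 7 B                               ≡⟨ iterate-+ (F i) x 9 7 ⟨
  It i 16 x                              ∎
  where
  open ≤-Reasoning
  i = level (suc j)
  u = unionBound m r
  x = m + r + (5 + j)
  B = It i 9 x
  u≤B : u ≤ B
  u≤B = ≤-trans (union≤It m r) (≤-trans (It-mono 2 9 (+-monoʳ-≤ (m + r) (m≤m+n 4 (suc j)))) (It-level 9 x (2≤level (suc j))))

-- The last step avoids the wasteful uniform bound. Iteration starts at 2 + (4 + j), which is at
-- most F i 6, so `It-F` leaves the argument 6 + 33u without j; and 6 + 33u ≤ 64(1 + u) is the form
-- in which the union bound was prepared. The inner argument 4 + 6m equals 6(m+1) - 2, as `m` here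
-- is one less than the number of blocks.
gowers₂≤F : ∀ j m → gowersBound (suc j) m 2 ≤ F (level (suc j)) (F 2 (4 + 6 * m))
gowers₂≤F j m = begin
  gowersBound (suc j) m 2                 ≤⟨ Iter≤It {i = suc (level j)} {e = 6} (n≤1+n (3 + j)) (inner≤It j) (u * 3) 2 ⟩
  It (suc (level j)) (u * 3 * 11) (6 + j) ≤⟨ It-mono (suc (level j)) (u * 3 * 11) (≤-trans j+6≤ (i+n≤F i 3)) ⟩
  It (suc (level j)) (u * 3 * 11) (F i 6) ≡⟨ It-F (suc (level j)) (u * 3 * 11) 6 ⟩
  F i (6 + u * 3 * 11)                    ≤⟨ F-mono i 6+33u≤ ⟩
  F i (F 2 (4 + 6 * m))                   ∎
  where
  open ≤-Reasoning
  i = level (suc j)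
  u = unionBound m 2
  j+6≤ : 6 + j ≤ i + 6
  j+6≤ = ≤-trans (≤-reflexive (+-comm 6 j)) (+-monoˡ-≤ 6 (≤-trans (j≤level j) (m≤n+m (level j) 2)))
  6+33u≤ : 6 + u * 3 * 11 ≤ F 2 (4 + 6 * m)
  6+33u≤ = begin
    6 + u * 3 * 11       ≤⟨ ≤-from (58 + 31 * u) (solve 1 (λ u → con 6 :+ u :* con 3 :* con 11 :+ (con 58 :+ con 31 :* u) := con 64 :* (con 1 :+ u)) refl u) ⟩
    64 * suc u           ≤⟨ 64*[1+union]≤F {2} {3} 224≤F m ⟩
    F 2 (4 + 2 * m)      ≤⟨ F-mono 2 (+-monoʳ-≤ 4 (*-monoˡ-≤ m {2} {6} (s≤s (s≤s z≤n)))) ⟩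
    F 2 (4 + 6 * m)      ∎

level≡ : ∀ j → level j ≡ 2 + 2 * j
level≡ zero    = refl
level≡ (suc j) = trans (cong (2 +_) (level≡ j)) (cong (2 +_) (sym (*-suc 2 j)))

gowersBound≤f : ∀ j m → gowersBound (suc j) m 2 ≤ f (4 + 2 * suc j) (f 4 (6 * suc m ∸ 2))
gowersBound≤f j m = begin
  gowersBound (suc j) m 2                          ≤⟨ gowers₂≤F j m ⟩
  F (level (suc j)) (F 2 (4 + 6 * m))              ≡⟨ cong₂ F (level≡ (suc j)) (trans (F≡f 2 (4 + 6 * m)) (cong (λ x → f 4 (x ∸ 2)) (sym (*-suc 6 m)))) ⟩
  F (2 + 2 * suc j) (f 4 (6 * suc m ∸ 2))          ≡⟨ F≡f (2 + 2 * suc j) (f 4 (6 * suc m ∸ 2)) ⟩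
  f (4 + 2 * suc j) (f 4 (6 * suc m ∸ 2))          ∎
  where open ≤-Reasoning

mainTheorem2 : ∀ (k m : ℕ) → 2 ≤ k → 1 ≤ m →
    ∃[ n ] (IsG k m 2 n × n ≤ f (4 + 2 * (k ∸ 1)) (f 4 (6 * m ∸ 2)))
mainTheorem2 (suc zero) (suc m) (s≤s ()) _
mainTheorem2 (suc (suc j)) (suc m) _ _ =
  let n , isLeast , n≤ = least (λ n → homogeneous? (2 + j) n (s≤s z≤n) (suc m) 1) (gowersBound (suc j) m 2)
                               (gowers⇒homogeneous (gowers (suc j) m 2))
  in n , isLeast , ≤-trans n≤ (gowersBound≤f j m)
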